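{- Let $u$ be an odd prime and let $(x,y,z,n)$ be an exceptional solution of $[(u^2-4)n]^x+(4un)^y=[(u^2+4)n]^z$, with associated decomposition $u^2-4=u_1u_2$ (as defined in the context). If $u_1\equiv \pm 1 \pmod 8$, then $y$ is even.
   Context: Let $u$ be an odd prime. Consider the equation $[(u^2-4)n]^x+(4un)^y=[(u^2+4)n]^z$ in positive integers $x,y,z,n$. A solution $(x,y,z,n)$ is called exceptional if $n>1$ and $(x,y,z)\neq(2,2,2)$. It is known (from earlier work) that every exceptional solution satisfies $y>z>x$; moreover $\gcd(n,u^2+4)=1$, and $(u^2-4)^x=[(u^2+4)^z-(4u)^yn^{y-z}]\,n^{z-x}$ with the two factors on the right coprime. Hence there are unique coprime positive integers $u_1,u_2$ with $u_1u_2=u^2-4$, $(u^2+4)^z-(4u)^yn^{y-z}=u_1^x$ and $n^{z-x}=u_2^x$; this is the decomposition associated with the solution. -}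

module Defs where

open import Data.Nat using (ℕ; _+_; _*_; _∸_; _^_; _<_)
open import Data.Product using (_×_)
open import Relation.Binary.PropositionalEquality using (_≡_)
open import Relation.Nullary using (¬_)

Solution : ℕ → ℕ → ℕ → ℕ → ℕ → Set
Solution u x y z n =
  (0 < x) × (0 < y) × (0 < z) × (0 < n) ×
  (((u * u ∸ 4) * n) ^ x + (4 * u * n) ^ y ≡ ((u * u + 4) * n) ^ z)

Exceptional : ℕ → ℕ → ℕ → ℕ → ℕ → Set
Exceptional u x y z n =
  Solution u x y z n × (1 < n) × ¬ ((x ≡ 2) × (y ≡ 2) × (z ≡ 2))

{-# OPTIONS --safe #-}

-- Put U = u² + 4 = u₁u₂ + 8 and suppose that y is odd. Modulo 8 the equation gives U ≡ 5, z even,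
-- u₂ ≡ ±3 and n odd. Removing the common power of two from x and z - x leaves nʷ = u₂ˣ′ with
-- x = 2ᵏx′, z - x = 2ᵏw and x′, w not both even.
--   * w even, x′ odd: u₂ ≡ 1 (mod 8), a contradiction.
--   * w odd, x′ even: Uᶻ - u₁ˣ is a difference of 2ᵏ-th powers of numbers ≡ 5 and ≡ 1 (mod 8),
--     hence not divisible by 2ᵏ⁺³, but (4u)ʸ is, as y > 2ᵏ.
--   * both odd: modulo U one has 4u ≡ (u + 2)² and -4 ≡ u², so the equation gives
--     (n/U) = (u₁/U)ˣ. As U ≡ 1 (mod 4) and U ≡ 8 modulo u₁ and u₂, reciprocity gives
--     (uᵢ/U) = (8/uᵢ) = (2/uᵢ), which is 1 for u₁ and -1 for u₂. But nʷ = u₂ˣ′ forces (n/U) = (u₂/U).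
module Submission where

open import Defs
open import Data.Nat using (ℕ; _+_; _*_; _∸_; _^_; _<_; _%_)
open import Data.Nat.Primality using (Prime)
open import Data.Nat.Divisibility using (_∣_)
open import Data.Nat.Coprimality using (Coprime)
open import Data.Product using (_×_)
open import Data.Sum using (_⊎_)
open import Relation.Binary.PropositionalEquality using (_≡_)
open import Relation.Nullary using (¬_)

import Algebra.Properties.CommutativeMonoid.Sum as CommutativeMonoidSum
open import Data.Bool.Base using (Bool; true; false; T)
open import Data.Empty using (⊥-elim)
open import Data.Fin.Base using (Fin; toℕ; fromℕ<)
open import Data.Fin.Permutation using (Permutation; permutation)
import Data.Fin.Properties as Fin
open import Data.Integer.Base as ℤ using (ℤ; +_; -[1+_]; 0ℤ; 1ℤ; -1ℤ)
import Data.Integer.DivMod as ℤ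
import Data.Integer.Properties as ℤ
import Data.Integer.Tactic.RingSolver as ℤ-Solver
open import Data.Nat.Base as ℕ using (zero; suc; _≤_; z≤n; s≤s; z<s)
open import Data.Nat.Divisibility using (divides; ∣-trans; ∣-refl; *-pres-∣; m∣m*n)
import Data.Nat.DivMod as ℕ
open import Data.Nat.Induction using (<-rec)
import Data.Nat.Properties as ℕ
import Data.Nat.Tactic.RingSolver as ℕ-Solver
open import Data.Parity.Base as ℙ using (Parity; 0ℙ; 1ℙ)
import Data.Parity.Properties as ℙ
open import Data.Product using (∃; _,_; proj₁; proj₂)
open import Data.Sum using (inj₁; inj₂; [_,_]′; map)
open import Relation.Binary.Bundles using (Setoid)
open import Relation.Binary.Definitions using (tri<; tri≈; tri>)
open import Relation.Binary.PropositionalEquality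
  using (_≢_; refl; sym; trans; cong; cong₂; subst; subst₂; module ≡-Reasoning)
open import Relation.Nullary using (yes; no; contradiction)

open CommutativeMonoidSum ℙ.+-0-commutativeMonoid
  using (sum; sum-cong-≗; ∑-distrib-+; ∑-comm; sum-permute)

-- Congruences and units of ℤ/m

infix 4 _≋_[mod_]

-- The quotient is carried as data, so that each rule for congruences comes down to a polynomial
-- identity.
record _≋_[mod_] (x y : ℤ) (m : ℕ) : Set where
  constructor congruent
  field
    quotient : ℤ
    equality : x ≡ y ℤ.+ quotient ℤ.* + m

module _ {m : ℕ} where

  mod-reflexive : ∀ {x y} → x ≡ y → x ≋ y [mod m ]
  mod-reflexive {x} refl = congruent 0ℤ (lemma x (+ m))
    where
    lemma : ∀ x m → x ≡ x ℤ.+ 0ℤ ℤ.* m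
    lemma = ℤ-Solver.solve-∀

  mod-refl : ∀ {x} → x ≋ x [mod m ]
  mod-refl = mod-reflexive refl

  mod-sym : ∀ {x y} → x ≋ y [mod m ] → y ≋ x [mod m ]
  mod-sym {y = y} (congruent q eq) =
    congruent (ℤ.- q) (trans (lemma y q (+ m)) (cong (ℤ._+ ℤ.- q ℤ.* + m) (sym eq)))
    where
    lemma : ∀ y q m → y ≡ (y ℤ.+ q ℤ.* m) ℤ.+ ℤ.- q ℤ.* m
    lemma = ℤ-Solver.solve-∀

  mod-trans : ∀ {x y z} → x ≋ y [mod m ] → y ≋ z [mod m ] → x ≋ z [mod m ]
  mod-trans {z = z} (congruent p refl) (congruent q refl) = congruent (p ℤ.+ q) (lemma z p q (+ m))
    where
    lemma : ∀ z p q m → (z ℤ.+ q ℤ.* m) ℤ.+ p ℤ.* m ≡ z ℤ.+ (p ℤ.+ q) ℤ.* m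
    lemma = ℤ-Solver.solve-∀

  mod-+ : ∀ {x y z w} → x ≋ y [mod m ] → z ≋ w [mod m ] → x ℤ.+ z ≋ y ℤ.+ w [mod m ]
  mod-+ {y = y} {w = w} (congruent p refl) (congruent q refl) =
    congruent (p ℤ.+ q) (lemma y w p q (+ m))
    where
    lemma : ∀ y w p q m → (y ℤ.+ p ℤ.* m) ℤ.+ (w ℤ.+ q ℤ.* m) ≡ (y ℤ.+ w) ℤ.+ (p ℤ.+ q) ℤ.* m
    lemma = ℤ-Solver.solve-∀

  mod-* : ∀ {x y z w} → x ≋ y [mod m ] → z ≋ w [mod m ] → x ℤ.* z ≋ y ℤ.* w [mod m ]
  mod-* {y = y} {w = w} (congruent p refl) (congruent q refl) =
    congruent (y ℤ.* q ℤ.+ p ℤ.* w ℤ.+ p ℤ.* q ℤ.* + m) (lemma y w p q (+ m))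
    where
    lemma : ∀ y w p q m → (y ℤ.+ p ℤ.* m) ℤ.* (w ℤ.+ q ℤ.* m) ≡ y ℤ.* w ℤ.+ (y ℤ.* q ℤ.+ p ℤ.* w ℤ.+ p ℤ.* q ℤ.* m) ℤ.* m
    lemma = ℤ-Solver.solve-∀

  mod-^ : ∀ {x y} k → x ≋ y [mod m ] → x ℤ.^ k ≋ y ℤ.^ k [mod m ]
  mod-^ zero    x≡y = mod-refl
  mod-^ (suc k) x≡y = mod-* x≡y (mod-^ k x≡y)

  private
    mod-< : ∀ {a b} q → a < m → + a ≡ + b ℤ.+ + q ℤ.* + m → a ≡ b
    mod-< {a} {b} zero    a<m eq = ℤ.+-injective (trans eq (lemma (+ b) (+ m)))
      where
      lemma : ∀ b m → b ℤ.+ 0ℤ ℤ.* m ≡ b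
      lemma = ℤ-Solver.solve-∀
    mod-< {a} {b} (suc q) a<m eq = contradiction a<m (ℕ.≤⇒≯ (begin
      m                     ≤⟨ ℕ.m≤m+n m (q ℕ.* m) ⟩
      suc q ℕ.* m           ≤⟨ ℕ.m≤n+m _ b ⟩
      b ℕ.+ suc q ℕ.* m     ≡⟨ ℤ.+-injective (trans (cong (λ z → + b ℤ.+ z) (ℤ.pos-* (suc q) m)) (sym eq)) ⟩
      a                     ∎))
      where open ℕ.≤-Reasoning

  mod-injective : ∀ {a b} → a < m → b < m → + a ≋ + b [mod m ] → a ≡ b
  mod-injective a<m b<m (congruent (+ q) eq)      = mod-< q a<m eq
  -- Exchanging the two sides turns the negative quotient into the positive `suc q`.
  mod-injective a<m b<m a≡b@(congruent -[1+ q ] _) =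
    sym (mod-< (suc q) b<m (_≋_[mod_].equality (mod-sym a≡b)))

mod-setoid : ℕ → Setoid _ _
mod-setoid m = record
  { Carrier = ℤ ; _≈_ = _≋_[mod m ]
  ; isEquivalence = record { refl = mod-refl ; sym = mod-sym ; trans = mod-trans } }

-- Coprimality to m in the form of an explicit inverse: it gives cancellation at once, and later the
-- inverse of a permutation.
record Unit (m : ℕ) (a : ℤ) : Set where
  constructor unit
  field
    inverse   : ℤ
    a*inverse : a ℤ.* inverse ≋ 1ℤ [mod m ]

module _ {m : ℕ} where

  unit-≡ : ∀ {a b} → a ≋ b [mod m ] → Unit m b → Unit m a
  unit-≡ a≡b (unit c bc≡1) = unit c (mod-trans (mod-* a≡b mod-refl) bc≡1)

  unit-* : ∀ {a b} → Unit m a → Unit m b → Unit m (a ℤ.* b)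
  unit-* {a} {b} (unit c ac≡1) (unit d bd≡1) =
    unit (c ℤ.* d) (mod-trans (mod-reflexive (lemma a b c d)) (mod-* ac≡1 bd≡1))
    where
    lemma : ∀ a b c d → a ℤ.* b ℤ.* (c ℤ.* d) ≡ a ℤ.* c ℤ.* (b ℤ.* d)
    lemma = ℤ-Solver.solve-∀

  unit-*ˡ : ∀ a b → Unit m (a ℤ.* b) → Unit m a
  unit-*ˡ a b (unit c abc≡1) =
    unit (b ℤ.* c) (mod-trans (mod-reflexive (sym (ℤ.*-assoc a b c))) abc≡1)

  unit-*ʳ : ∀ a b → Unit m (a ℤ.* b) → Unit m b
  unit-*ʳ a b ab = unit-*ˡ b a (subst (Unit m) (ℤ.*-comm a b) ab)

  unit-root : ∀ {a} k → 0 < k → Unit m (a ℤ.^ k) → Unit m a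
  unit-root {a} (suc k) _ = unit-*ˡ a (a ℤ.^ k)

  unit-cancel : ∀ {a x} → Unit m a → a ℤ.* x ≋ 0ℤ [mod m ] → x ≋ 0ℤ [mod m ]
  unit-cancel {a} {x} (unit b ab≡1) ax≡0 = begin
    x             ≡⟨ ℤ.*-identityˡ x ⟨
    1ℤ ℤ.* x        ≈⟨ mod-* ab≡1 mod-refl ⟨
    a ℤ.* b ℤ.* x     ≡⟨ lemma a b x ⟩
    b ℤ.* (a ℤ.* x)   ≈⟨ mod-* (mod-refl {x = b}) ax≡0 ⟩
    b ℤ.* 0ℤ        ≡⟨ ℤ.*-zeroʳ b ⟩
    0ℤ            ∎
    where
    open import Relation.Binary.Reasoning.Setoid (mod-setoid m)
    lemma : ∀ a b x → a ℤ.* b ℤ.* x ≡ b ℤ.* (a ℤ.* x)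
    lemma = ℤ-Solver.solve-∀

  unit-^ : ∀ {a} k → Unit m a → Unit m (a ℤ.^ k)
  unit-^ zero    _ = unit 1ℤ mod-refl
  unit-^ (suc k) a = unit-* a (unit-^ k a)

-- The Jacobi symbol and quadratic reciprocity

-- The sign (-1)ᵖ. Symbols take values in the additive group `Parity`, so that products of signs
-- become sums.
⟦_⟧ : Parity → ℤ
⟦ 0ℙ ⟧ = 1ℤ
⟦ 1ℙ ⟧ = -1ℤ

⟦⟧-+ : ∀ p q → ⟦ p ⟧ ℤ.* ⟦ q ⟧ ≡ ⟦ p ℙ.+ q ⟧
⟦⟧-+ 0ℙ q  = ℤ.*-identityˡ ⟦ q ⟧
⟦⟧-+ 1ℙ 0ℙ = refl
⟦⟧-+ 1ℙ 1ℙ = refl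

parity-odd : ∀ h → ℕ.parity (suc (h ℕ.+ h)) ≡ 1ℙ
parity-odd h = begin
  ℕ.parity (1 ℕ.+ (h ℕ.+ h))       ≡⟨ ℙ.+-homo-+ 1 (h ℕ.+ h) ⟩
  1ℙ ℙ.+ ℕ.parity (h ℕ.+ h)        ≡⟨ cong (1ℙ ℙ.+_) (ℙ.+-homo-+ h h) ⟩
  1ℙ ℙ.+ (ℕ.parity h ℙ.+ ℕ.parity h) ≡⟨ cong (1ℙ ℙ.+_) (ℙ.p+p≡0ℙ (ℕ.parity h)) ⟩
  1ℙ                             ∎
  where open ≡-Reasoning

sum-const : ∀ n p → sum {n} (λ _ → p) ≡ ℕ.parity n ℙ.* p
sum-const zero    p = refl
sum-const (suc n) p = begin
  p ℙ.+ sum {n} (λ _ → p)            ≡⟨ cong (p ℙ.+_) (sum-const n p) ⟩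
  (1ℙ ℙ.* p) ℙ.+ (ℕ.parity n ℙ.* p)      ≡⟨ ℙ.*-distribʳ-+ p 1ℙ (ℕ.parity n) ⟨
  (1ℙ ℙ.+ ℕ.parity n) ℙ.* p          ≡⟨ cong (ℙ._* p) (ℙ.+-homo-+ 1 n) ⟨
  ℕ.parity (suc n) ℙ.* p             ∎
  where open ≡-Reasoning

1+ᶠ : ∀ {h} → Fin h → ℕ
1+ᶠ i = suc (toℕ i)

1+ᶠ≤ : ∀ {h} (i : Fin h) → 1+ᶠ i ≤ h
1+ᶠ≤ = Fin.toℕ<n

module Symbol (h : ℕ) where

  m : ℕ
  m = suc (h ℕ.+ h)

  -- The least absolute remainder, in [-h, h]. The field `parity-%ℕ` serves Eisenstein's argument: m
  -- is odd, so replacing a remainder r by m - r flips its parity, and this happens exactly for the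
  -- negative sign.
  record AbsoluteRemainder (x : ℤ) : Set where
    field
      sign      : Parity
      abs       : ℕ
      abs≤h     : abs ≤ h
      x≡±abs    : x ≋ ⟦ sign ⟧ ℤ.* + abs [mod m ]
      parity-%ℕ : ℕ.parity (x ℤ.%ℕ m) ≡ ℕ.parity abs ℙ.+ sign

  abstract
    absoluteRemainder : ∀ x → AbsoluteRemainder x
    absoluteRemainder x with x ℤ.%ℕ m ℕ.≤? h
    ... | yes r≤h = record
      { sign = 0ℙ ; abs = x ℤ.%ℕ m ; abs≤h = r≤h
      ; x≡±abs = congruent (x ℤ./ℕ m) (trans (ℤ.a≡a%ℕn+[a/ℕn]*n x m)
          (cong (ℤ._+ x ℤ./ℕ m ℤ.* + m) (sym (ℤ.*-identityˡ (+ (x ℤ.%ℕ m))))))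
      ; parity-%ℕ = sym (ℙ.+-identityʳ _) }
    ... | no r≰h = record
      { sign = 1ℙ ; abs = m ℕ.∸ r
      ; abs≤h = ℕ.m≤n+o⇒m∸n≤o m r (ℕ.+-monoˡ-≤ h (ℕ.≰⇒> r≰h))
      ; x≡±abs = congruent (x ℤ./ℕ m ℤ.+ 1ℤ) (trans (ℤ.a≡a%ℕn+[a/ℕn]*n x m)
          (trans (lemma (+ r) (x ℤ./ℕ m) (+ m)) (cong (λ s → -1ℤ ℤ.* s ℤ.+ (x ℤ./ℕ m ℤ.+ 1ℤ) ℤ.* + m)
            (trans (ℤ.m-n≡m⊖n m r) (ℤ.⊖-≥ r≤m)))))
      ; parity-%ℕ = parity-r (ℕ.parity r) (ℕ.parity (m ℕ.∸ r)) (begin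
          ℕ.parity (m ℕ.∸ r) ℙ.+ ℕ.parity r ≡⟨ ℙ.+-homo-+ (m ℕ.∸ r) r ⟨
          ℕ.parity (m ℕ.∸ r ℕ.+ r)       ≡⟨ cong ℕ.parity (ℕ.m∸n+n≡m r≤m) ⟩
          ℕ.parity m                   ≡⟨ parity-odd h ⟩
          1ℙ                           ∎) }
      where
      open ≡-Reasoning
      r : ℕ
      r = x ℤ.%ℕ m
      r≤m : r ≤ m
      r≤m = ℕ.<⇒≤ (ℤ.n%ℕd<d x m)
      lemma : ∀ r q m → r ℤ.+ q ℤ.* m ≡ -1ℤ ℤ.* (m ℤ.- r) ℤ.+ (q ℤ.+ 1ℤ) ℤ.* m
      lemma = ℤ-Solver.solve-∀
      parity-r : ∀ p q → q ℙ.+ p ≡ 1ℙ → p ≡ q ℙ.+ 1ℙ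
      parity-r 0ℙ 1ℙ _ = refl
      parity-r 1ℙ 0ℙ _ = refl

  sign : ℤ → Parity
  sign x = AbsoluteRemainder.sign (absoluteRemainder x)

  abs : ℤ → ℕ
  abs x = AbsoluteRemainder.abs (absoluteRemainder x)

  abs≤h : ∀ x → abs x ≤ h
  abs≤h x = AbsoluteRemainder.abs≤h (absoluteRemainder x)

  x≡±abs : ∀ x → x ≋ ⟦ sign x ⟧ ℤ.* + abs x [mod m ]
  x≡±abs x = AbsoluteRemainder.x≡±abs (absoluteRemainder x)

  private
    ≤h⇒<m : ∀ {a} → a ≤ h → a < m
    ≤h⇒<m a≤h = s≤s (ℕ.≤-trans a≤h (ℕ.m≤m+n h h))

    no-opposites : ∀ {a b} → 0 < a → a ≤ h → b ≤ h → ¬ (+ (a ℕ.+ b) ≋ 0ℤ [mod m ])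
    no-opposites {a} 0<a a≤h b≤h a+b≡0 = ℕ.<⇒≢ 0<a (sym (ℕ.m+n≡0⇒m≡0 a
      (mod-injective (s≤s (ℕ.+-mono-≤ a≤h b≤h)) z<s a+b≡0)))

  -- For equal signs this is uniqueness of remainders below m. Opposite signs would make m divide a
  -- + b, but 0 < a + b ≤ 2h < m.
  ±-injective : ∀ p q {a b} → 0 < a → a ≤ h → b ≤ h →
    ⟦ p ⟧ ℤ.* + a ≋ ⟦ q ⟧ ℤ.* + b [mod m ] → p ≡ q × a ≡ b
  ±-injective 0ℙ 0ℙ {a} {b} 0<a a≤h b≤h eq = refl , mod-injective (≤h⇒<m a≤h) (≤h⇒<m b≤h)
    (subst₂ _≋_[mod m ] (ℤ.*-identityˡ (+ a)) (ℤ.*-identityˡ (+ b)) eq)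
  ±-injective 0ℙ 1ℙ {a} {b} 0<a a≤h b≤h eq = contradiction
    (subst₂ _≋_[mod m ] (lemma₁ (+ a) (+ b)) (lemma₂ (+ b)) (mod-+ eq mod-refl))
    (no-opposites 0<a a≤h b≤h)
    where
    lemma₁ : ∀ a b → 1ℤ ℤ.* a ℤ.+ b ≡ a ℤ.+ b
    lemma₁ = ℤ-Solver.solve-∀
    lemma₂ : ∀ b → -1ℤ ℤ.* b ℤ.+ b ≡ 0ℤ
    lemma₂ = ℤ-Solver.solve-∀
  ±-injective 1ℙ 0ℙ {a} {b} 0<a a≤h b≤h eq = contradiction
    (mod-sym (subst₂ _≋_[mod m ] (lemma₂ (+ a)) (lemma₁ (+ a) (+ b)) (mod-+ eq (mod-refl {x = + a}))))
    (no-opposites 0<a a≤h b≤h)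
    where
    lemma₁ : ∀ a b → 1ℤ ℤ.* b ℤ.+ a ≡ a ℤ.+ b
    lemma₁ = ℤ-Solver.solve-∀
    lemma₂ : ∀ b → -1ℤ ℤ.* b ℤ.+ b ≡ 0ℤ
    lemma₂ = ℤ-Solver.solve-∀
  ±-injective 1ℙ 1ℙ {a} {b} 0<a a≤h b≤h eq = refl , mod-injective (≤h⇒<m a≤h) (≤h⇒<m b≤h)
    (subst₂ _≋_[mod m ] (lemma (+ a)) (lemma (+ b)) (mod-* (mod-refl {x = -1ℤ}) eq))
    where
    lemma : ∀ a → -1ℤ ℤ.* (-1ℤ ℤ.* a) ≡ a
    lemma = ℤ-Solver.solve-∀

  sign-abs-unique : ∀ {x p s} → 0 < s → s ≤ h → x ≋ ⟦ p ⟧ ℤ.* + s [mod m ] →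
    sign x ≡ p × abs x ≡ s
  sign-abs-unique {x} {p} 0<s s≤h x≡ps =
    let p≡ , s≡ = ±-injective p (sign x) 0<s s≤h (abs≤h x) (mod-trans (mod-sym x≡ps) (x≡±abs x))
    in sym p≡ , sym s≡

  unit-≢0 : ∀ {a} k → Unit m a → 0 < k → k ≤ h → ¬ (a ℤ.* + k ≋ 0ℤ [mod m ])
  unit-≢0 k ua 0<k k≤h ak≡0 =
    ℕ.<⇒≢ 0<k (sym (mod-injective (≤h⇒<m k≤h) z<s (unit-cancel ua ak≡0)))

  unit-abs>0 : ∀ {a} k → Unit m a → 0 < k → k ≤ h → 0 < abs (a ℤ.* + k)
  unit-abs>0 {a} k ua 0<k k≤h = ℕ.n≢0⇒n>0 λ abs≡0 → unit-≢0 k ua 0<k k≤h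
    (mod-trans (x≡±abs (a ℤ.* + k)) (mod-reflexive (trans
      (cong (λ s → ⟦ sign (a ℤ.* + k) ⟧ ℤ.* + s) abs≡0)
      (ℤ.*-zeroʳ ⟦ sign (a ℤ.* + k) ⟧))))

  -- Reduce bk to ±s first and as to ±t next; the two signs multiply. The first half makes the
  -- symbol multiplicative, the second makes k ↦ |ak| compatible with products of units.
  sign-abs-* : ∀ {a b} k → Unit m a → Unit m b → 0 < k → k ≤ h →
    sign (a ℤ.* b ℤ.* + k) ≡ sign (b ℤ.* + k) ℙ.+ sign (a ℤ.* + abs (b ℤ.* + k)) ×
    abs (a ℤ.* b ℤ.* + k) ≡ abs (a ℤ.* + abs (b ℤ.* + k))
  sign-abs-* {a} {b} k ua ub 0<k k≤h =
    sign-abs-unique (unit-abs>0 _ ua (unit-abs>0 k ub 0<k k≤h) (abs≤h _)) (abs≤h _) (begin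
      a ℤ.* b ℤ.* + k             ≡⟨ ℤ.*-assoc a b (+ k) ⟩
      a ℤ.* (b ℤ.* + k)           ≈⟨ mod-* (mod-refl {x = a}) (x≡±abs (b ℤ.* + k)) ⟩
      a ℤ.* (⟦ p ⟧ ℤ.* + s)       ≡⟨ lemma a ⟦ p ⟧ (+ s) ⟩
      ⟦ p ⟧ ℤ.* (a ℤ.* + s)       ≈⟨ mod-* (mod-refl {x = ⟦ p ⟧}) (x≡±abs (a ℤ.* + s)) ⟩
      ⟦ p ⟧ ℤ.* (⟦ q ⟧ ℤ.* + t)   ≡⟨ ℤ.*-assoc ⟦ p ⟧ ⟦ q ⟧ (+ t) ⟨
      ⟦ p ⟧ ℤ.* ⟦ q ⟧ ℤ.* + t     ≡⟨ cong (ℤ._* + t) (⟦⟧-+ p q) ⟩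
      ⟦ p ℙ.+ q ⟧ ℤ.* + t         ∎)
    where
    open import Relation.Binary.Reasoning.Setoid (mod-setoid m)
    s = abs (b ℤ.* + k)
    p = sign (b ℤ.* + k)
    q = sign (a ℤ.* + s)
    t = abs (a ℤ.* + s)
    lemma : ∀ a p s → a ℤ.* (p ℤ.* s) ≡ p ℤ.* (a ℤ.* s)
    lemma = ℤ-Solver.solve-∀

  -- The map k ↦ |ak| on {1, ..., h}, where the index i stands for k = i + 1. The predecessor loses
  -- nothing, as |ak| > 0 for a unit a.
  multiply : ∀ {a} → Unit m a → Fin h → Fin h
  multiply {a} ua i = fromℕ< {ℕ.pred (abs (a ℤ.* + 1+ᶠ i))}
    (subst (_≤ h) (sym (suc-pred i)) (abs≤h _))
    where
    suc-pred : ∀ i → suc (ℕ.pred (abs (a ℤ.* + 1+ᶠ i))) ≡ abs (a ℤ.* + 1+ᶠ i)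
    suc-pred i = ℕ.suc-pred _ {{ℕ.>-nonZero (unit-abs>0 (1+ᶠ i) ua z<s (1+ᶠ≤ i))}}

  1+ᶠ-multiply : ∀ {a} (ua : Unit m a) i → 1+ᶠ (multiply ua i) ≡ abs (a ℤ.* + 1+ᶠ i)
  1+ᶠ-multiply {a} ua i = trans (cong suc (Fin.toℕ-fromℕ< _))
    (ℕ.suc-pred _ {{ℕ.>-nonZero (unit-abs>0 (1+ᶠ i) ua z<s (1+ᶠ≤ i))}})

  multiply-inverse : ∀ {a b} (ua : Unit m a) (ub : Unit m b) → a ℤ.* b ≋ 1ℤ [mod m ] →
    ∀ i → multiply ua (multiply ub i) ≡ i
  multiply-inverse {a} {b} ua ub ab≡1 i = Fin.toℕ-injective (ℕ.suc-injective (begin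
    1+ᶠ (multiply ua (multiply ub i))       ≡⟨ 1+ᶠ-multiply ua (multiply ub i) ⟩
    abs (a ℤ.* + 1+ᶠ (multiply ub i))        ≡⟨ cong (λ k → abs (a ℤ.* + k)) (1+ᶠ-multiply ub i) ⟩
    abs (a ℤ.* + abs (b ℤ.* + 1+ᶠ i))        ≡⟨ proj₂ (sign-abs-* (1+ᶠ i) ua ub z<s (1+ᶠ≤ i)) ⟨
    abs (a ℤ.* b ℤ.* + 1+ᶠ i)                ≡⟨ proj₂ (sign-abs-unique {p = 0ℙ} z<s (1+ᶠ≤ i) (mod-* ab≡1 mod-refl)) ⟩
    1+ᶠ i                                   ∎))
    where open ≡-Reasoning

  multiplication : ∀ {a} → Unit m a → Permutation h h
  multiplication {a} ua@(unit b ab≡1) = permutation (multiply ua) (multiply ub)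
    (multiply-inverse ua ub ab≡1) (multiply-inverse ub ua ba≡1)
    where
    ba≡1 : b ℤ.* a ≋ 1ℤ [mod m ]
    ba≡1 = subst (_≋ 1ℤ [mod m ]) (ℤ.*-comm a b) ab≡1
    ub : Unit m b
    ub = unit a ba≡1

  -- The Jacobi symbol of a modulo m, written additively and defined through the Gauss–Schering lemma.
  jacobi : ℤ → Parity
  jacobi a = sum {h} λ i → sign (a ℤ.* + 1+ᶠ i)

  jacobi-cong : ∀ {a b} → Unit m b → a ≋ b [mod m ] → jacobi a ≡ jacobi b
  jacobi-cong ub a≡b = sum-cong-≗ {n = h} λ i → proj₁ (sign-abs-unique
    (unit-abs>0 (1+ᶠ i) ub z<s (1+ᶠ≤ i)) (abs≤h _)
    (mod-trans (mod-* a≡b mod-refl) (x≡±abs _)))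

  -- Multiplication by a unit permutes 1, ..., h up to sign, so the sum is merely reindexed.
  sum-multiply : ∀ {a} → Unit m a → ∀ (f : ℕ → Parity) →
    sum {h} (λ i → f (abs (a ℤ.* + 1+ᶠ i))) ≡ sum {h} (λ i → f (1+ᶠ i))
  sum-multiply ua f = trans
    (sum-cong-≗ {n = h} λ i → cong f (sym (1+ᶠ-multiply ua i)))
    (sym (sum-permute {n = h} (λ i → f (1+ᶠ i)) (multiplication ua)))

  -- By `sign-abs-*` the sum splits into the signs of bk and those of a|bk|; in the latter |bk| runs
  -- through 1, ..., h again.
  jacobi-* : ∀ {a b} → Unit m a → Unit m b → jacobi (a ℤ.* b) ≡ jacobi a ℙ.+ jacobi b
  jacobi-* {a} {b} ua ub = begin
    jacobi (a ℤ.* b)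
      ≡⟨ (sum-cong-≗ {n = h} λ i → proj₁ (sign-abs-* (1+ᶠ i) ua ub z<s (1+ᶠ≤ i))) ⟩
    sum {h} (λ i → sign (b ℤ.* + 1+ᶠ i) ℙ.+ sign (a ℤ.* + abs (b ℤ.* + 1+ᶠ i)))
      ≡⟨ ∑-distrib-+ {n = h} (λ i → sign (b ℤ.* + 1+ᶠ i)) (λ i → sign (a ℤ.* + abs (b ℤ.* + 1+ᶠ i))) ⟩
    jacobi b ℙ.+ sum {h} (λ i → sign (a ℤ.* + abs (b ℤ.* + 1+ᶠ i)))
      ≡⟨ cong (jacobi b ℙ.+_) (sum-multiply ub (λ k → sign (a ℤ.* + k))) ⟩
    jacobi b ℙ.+ jacobi a
      ≡⟨ ℙ.+-comm (jacobi b) (jacobi a) ⟩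
    jacobi a ℙ.+ jacobi b ∎
    where open ≡-Reasoning

  -- The parity of h(h + 1)/2 = (m² - 1)/8, which is the exponent in the supplementary law for 2.
  triangular-parity : Parity
  triangular-parity = sum {h} λ i → ℕ.parity (1+ᶠ i)

  quotient-sum : ℕ → Parity
  quotient-sum a = sum {h} λ i → ℕ.parity (a ℕ.* 1+ᶠ i ℕ./ m)

  -- Division with remainder read modulo 2: m is odd, so qm has the parity of q, and `parity-%ℕ`
  -- rewrites the parity of the remainder.
  parity-division : ∀ a k → ℕ.parity (a ℕ.* k) ≡
    ℕ.parity (a ℕ.* k ℕ./ m) ℙ.+ (ℕ.parity (abs (+ a ℤ.* + k)) ℙ.+ sign (+ a ℤ.* + k))
  parity-division a k = begin
    ℕ.parity (a ℕ.* k)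
      ≡⟨ cong ℕ.parity (ℕ.m≡m%n+[m/n]*n (a ℕ.* k) m) ⟩
    ℕ.parity (a ℕ.* k ℕ.% m ℕ.+ q ℕ.* m)
      ≡⟨ ℙ.+-homo-+ (a ℕ.* k ℕ.% m) (q ℕ.* m) ⟩
    ℕ.parity (a ℕ.* k ℕ.% m) ℙ.+ ℕ.parity (q ℕ.* m)
      ≡⟨ cong₂ ℙ._+_ parity-remainder parity-q*m ⟩
    (ℕ.parity (abs (+ a ℤ.* + k)) ℙ.+ sign (+ a ℤ.* + k)) ℙ.+ ℕ.parity q
      ≡⟨ ℙ.+-comm _ (ℕ.parity q) ⟩
    ℕ.parity q ℙ.+ (ℕ.parity (abs (+ a ℤ.* + k)) ℙ.+ sign (+ a ℤ.* + k)) ∎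
    where
    open ≡-Reasoning
    q = a ℕ.* k ℕ./ m
    parity-q*m : ℕ.parity (q ℕ.* m) ≡ ℕ.parity q
    parity-q*m = trans (ℙ.*-homo-* q m)
      (trans (cong (ℕ.parity q ℙ.*_) (parity-odd h)) (ℙ.*-identityʳ (ℕ.parity q)))
    parity-remainder : ℕ.parity (a ℕ.* k ℕ.% m) ≡ ℕ.parity (abs (+ a ℤ.* + k)) ℙ.+ sign (+ a ℤ.* + k)
    parity-remainder = trans (cong (λ x → ℕ.parity (x ℤ.%ℕ m)) (ℤ.pos-* a k))
      (AbsoluteRemainder.parity-%ℕ (absoluteRemainder (+ a ℤ.* + k)))

  -- Summing a k = q m + r over k ≤ h modulo 2, where the absolute remainders permute 1, …, h.
  eisenstein : ∀ a → Unit m (+ a) →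
    sum {h} (λ i → ℕ.parity (a ℕ.* 1+ᶠ i)) ≡ quotient-sum a ℙ.+ (triangular-parity ℙ.+ jacobi (+ a))
  eisenstein a ua = begin
    sum {h} (λ i → ℕ.parity (a ℕ.* 1+ᶠ i))
      ≡⟨ (sum-cong-≗ {n = h} λ i → parity-division a (1+ᶠ i)) ⟩
    sum {h} (λ i → q i ℙ.+ (r i ℙ.+ s i))
      ≡⟨ ∑-distrib-+ {n = h} q (λ i → r i ℙ.+ s i) ⟩
    quotient-sum a ℙ.+ sum {h} (λ i → r i ℙ.+ s i)
      ≡⟨ cong (quotient-sum a ℙ.+_) (∑-distrib-+ {n = h} r s) ⟩
    quotient-sum a ℙ.+ (sum {h} r ℙ.+ jacobi (+ a))
      ≡⟨ cong (λ t → quotient-sum a ℙ.+ (t ℙ.+ jacobi (+ a))) (sum-multiply ua ℕ.parity) ⟩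
    quotient-sum a ℙ.+ (triangular-parity ℙ.+ jacobi (+ a)) ∎
    where
    open ≡-Reasoning
    q r s : Fin h → Parity
    q i = ℕ.parity (a ℕ.* 1+ᶠ i ℕ./ m)
    r i = ℕ.parity (abs (+ a ℤ.* + 1+ᶠ i))
    s i = sign (+ a ℤ.* + 1+ᶠ i)

  -- For odd a the left side of `eisenstein` is `triangular-parity`, which cancels against the same
  -- term on the right.
  jacobi-odd : ∀ a → ℕ.parity a ≡ 1ℙ → Unit m (+ a) → jacobi (+ a) ≡ quotient-sum a
  jacobi-odd a a-odd ua = cancel (quotient-sum a) triangular-parity (jacobi (+ a)) (trans
    (sum-cong-≗ {n = h} λ i → sym (trans (ℙ.*-homo-* a (1+ᶠ i)) (cong (ℙ._* ℕ.parity (1+ᶠ i)) a-odd)))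
    (eisenstein a ua))
    where
    cancel : ∀ q k j → k ≡ q ℙ.+ (k ℙ.+ j) → j ≡ q
    cancel 0ℙ 0ℙ j eq = sym eq
    cancel 0ℙ 1ℙ 0ℙ eq = refl
    cancel 1ℙ 0ℙ 1ℙ eq = refl
    cancel 1ℙ 1ℙ 1ℙ eq = refl

  unit-2 : Unit m (+ 2)
  -- The inverse of 2 is h + 1, because 2(h + 1) = m + 1.
  unit-2 = unit (+ suc h) (congruent 1ℤ (begin
    + 2 ℤ.* + suc h            ≡⟨ ℤ.pos-* 2 (suc h) ⟨
    + (2 ℕ.* suc h)            ≡⟨ cong +_ (lemma h) ⟩
    + (1 ℕ.+ 1 ℕ.* m)          ≡⟨ cong (λ x → 1ℤ ℤ.+ x) (ℤ.pos-* 1 m) ⟩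
    1ℤ ℤ.+ 1ℤ ℤ.* + m          ∎))
    where
    open ≡-Reasoning
    lemma : ∀ h → 2 ℕ.* suc h ≡ 1 ℕ.+ 1 ℕ.* suc (h ℕ.+ h)
    lemma = ℕ-Solver.solve-∀

  -- In `eisenstein` with a = 2 the left side is even, and every quotient vanishes because 2k ≤ 2h <
  -- m.
  jacobi-2 : jacobi (+ 2) ≡ triangular-parity
  jacobi-2 = cancel triangular-parity (jacobi (+ 2)) (begin
    0ℙ                                               ≡⟨ sum-0 ⟨
    sum {h} (λ _ → 0ℙ)                               ≡⟨ (sum-cong-≗ {n = h} λ i → ℙ.*-homo-* 2 (1+ᶠ i)) ⟨
    sum {h} (λ i → ℕ.parity (2 ℕ.* 1+ᶠ i))           ≡⟨ eisenstein 2 unit-2 ⟩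
    quotient-sum 2 ℙ.+ (triangular-parity ℙ.+ jacobi (+ 2))   ≡⟨ cong (ℙ._+ (triangular-parity ℙ.+ jacobi (+ 2)))
                                                        (trans (sum-cong-≗ {n = h} q≡0) sum-0) ⟩
    triangular-parity ℙ.+ jacobi (+ 2)                        ∎)
    where
    open ≡-Reasoning
    sum-0 : sum {h} (λ _ → 0ℙ) ≡ 0ℙ
    sum-0 = trans (sum-const h 0ℙ) (ℙ.*-zeroʳ (ℕ.parity h))
    q≡0 : ∀ i → ℕ.parity (2 ℕ.* 1+ᶠ i ℕ./ m) ≡ 0ℙ
    q≡0 i = cong ℕ.parity (ℕ.m<n⇒m/n≡0 (s≤s (ℕ.+-mono-≤ (1+ᶠ≤ i)
      (subst (_≤ h) (sym (ℕ.+-identityʳ (1+ᶠ i))) (1+ᶠ≤ i)))))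
    cancel : ∀ k j → 0ℙ ≡ k ℙ.+ j → j ≡ k
    cancel 0ℙ 0ℙ eq = refl
    cancel 1ℙ 1ℙ eq = refl

  jacobi-1 : jacobi 1ℤ ≡ 0ℙ
  jacobi-1 = ℙ.+-cancelˡ-≡ (jacobi 1ℤ) (jacobi 1ℤ) 0ℙ (trans
    (sym (jacobi-* unit-1 unit-1)) (sym (ℙ.+-identityʳ (jacobi 1ℤ))))
    where
    unit-1 : Unit m 1ℤ
    unit-1 = unit 1ℤ mod-refl

  jacobi-^ : ∀ {a} k → Unit m a → jacobi (a ℤ.^ k) ≡ ℕ.parity k ℙ.* jacobi a
  jacobi-^ zero    ua = jacobi-1
  jacobi-^ {a} (suc k) ua = begin
    jacobi (a ℤ.* a ℤ.^ k)                           ≡⟨ jacobi-* ua (unit-^ k ua) ⟩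
    jacobi a ℙ.+ jacobi (a ℤ.^ k)                    ≡⟨ cong (jacobi a ℙ.+_) (jacobi-^ k ua) ⟩
    (1ℙ ℙ.* jacobi a) ℙ.+ (ℕ.parity k ℙ.* jacobi a)      ≡⟨ ℙ.*-distribʳ-+ (jacobi a) 1ℙ (ℕ.parity k) ⟨
    (1ℙ ℙ.+ ℕ.parity k) ℙ.* jacobi a                 ≡⟨ cong (ℙ._* jacobi a) (ℙ.+-homo-+ 1 k) ⟨
    ℕ.parity (suc k) ℙ.* jacobi a                    ∎
    where open ≡-Reasoning

-- Lattice-point count for quadratic reciprocity.

indicator : Bool → Parity
indicator true  = 1ℙ
indicator false = 0ℙ

indicator-⇔ : ∀ {b c} → (T b → T c) → (T c → T b) → indicator b ≡ indicator c
indicator-⇔ {false} {false} _ _ = refl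
indicator-⇔ {false} {true}  _ g = ⊥-elim (g _)
indicator-⇔ {true}  {false} f _ = ⊥-elim (f _)
indicator-⇔ {true}  {true}  _ _ = refl

count-< : ∀ g q → q ≤ g → sum {g} (λ j → indicator (toℕ j ℕ.<ᵇ q)) ≡ ℕ.parity q
count-< g       zero    _         = trans (sum-const g 0ℙ) (ℙ.*-zeroʳ (ℕ.parity g))
count-< (suc g) (suc q) (s≤s q≤g) = trans (cong (1ℙ ℙ.+_) (count-< g q q≤g)) (sym (ℙ.+-homo-+ 1 q))

module _ (h g : ℕ) where

  private
    m a : ℕ
    m = suc (h ℕ.+ h)
    a = suc (g ℕ.+ g)

  -- The floor of ak/m is the number of j ≥ 1 with mj < ak: equality never occurs, since a is a unit
  -- and 0 < k < m. The range j ≤ g suffices, because k ≤ h gives ak < (g + 1)m.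
  quotient-as-count : Unit m (+ a) → ∀ k → 0 < k → k ≤ h →
    ℕ.parity (a ℕ.* k ℕ./ m) ≡ sum {g} (λ j → indicator (m ℕ.* 1+ᶠ j ℕ.<ᵇ a ℕ.* k))
  quotient-as-count ua k 0<k k≤h = trans (sym (count-< g q (ℕ.≤-pred (ℕ.m<n*o⇒m/o<n q<))))
    (sum-cong-≗ {n = g} λ j → indicator-⇔
      (λ j<q → ℕ.<⇒<ᵇ (to j (ℕ.<ᵇ⇒< _ _ j<q)))
      (λ mj<ak → ℕ.<⇒<ᵇ (from j (ℕ.<ᵇ⇒< _ _ mj<ak))))
    where
    open ℕ.≤-Reasoning
    q = a ℕ.* k ℕ./ m
    lemma : ∀ g h → suc (suc (g ℕ.+ g) ℕ.* h) ℕ.+ (g ℕ.+ h) ≡ suc g ℕ.* suc (h ℕ.+ h)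
    lemma = ℕ-Solver.solve-∀
    q< : a ℕ.* k < suc g ℕ.* m
    q< = begin
      suc (a ℕ.* k)              ≤⟨ s≤s (ℕ.*-monoʳ-≤ a k≤h) ⟩
      suc (a ℕ.* h)              ≤⟨ ℕ.m≤m+n _ (g ℕ.+ h) ⟩
      suc (a ℕ.* h) ℕ.+ (g ℕ.+ h) ≡⟨ lemma g h ⟩
      suc g ℕ.* m                ∎
    mj≢ak : ∀ j → m ℕ.* j ≢ a ℕ.* k
    mj≢ak j mj≡ak = Symbol.unit-≢0 h k ua 0<k k≤h (congruent (+ j) (trans (sym (ℤ.pos-* a k))
      (trans (cong +_ (trans (sym mj≡ak) (ℕ.*-comm m j))) (trans (ℤ.pos-* j m) (sym (ℤ.+-identityˡ _))))))
    to : ∀ j → toℕ j < q → m ℕ.* 1+ᶠ j < a ℕ.* k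
    to j j<q = ℕ.≤∧≢⇒< (begin
      m ℕ.* 1+ᶠ j   ≡⟨ ℕ.*-comm m (1+ᶠ j) ⟩
      1+ᶠ j ℕ.* m   ≤⟨ ℕ.*-monoˡ-≤ m j<q ⟩
      q ℕ.* m       ≤⟨ ℕ.m/n*n≤m (a ℕ.* k) m ⟩
      a ℕ.* k       ∎) (mj≢ak (1+ᶠ j))
    from : ∀ j → m ℕ.* 1+ᶠ j < a ℕ.* k → toℕ j < q
    from j mj<ak = begin
      1+ᶠ j             ≡⟨ ℕ.m*n/n≡m (1+ᶠ j) m ⟨
      1+ᶠ j ℕ.* m ℕ./ m  ≤⟨ ℕ./-monoˡ-≤ m (subst (_≤ a ℕ.* k) (ℕ.*-comm m (1+ᶠ j)) (ℕ.<⇒≤ mj<ak)) ⟩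
      q                 ∎

  jacobi-as-count : Unit m (+ a) → Symbol.jacobi h (+ a) ≡
    sum {h} (λ i → sum {g} (λ j → indicator (m ℕ.* 1+ᶠ j ℕ.<ᵇ a ℕ.* 1+ᶠ i)))
  jacobi-as-count ua = trans (Symbol.jacobi-odd h a (parity-odd g) ua)
    (sum-cong-≗ {n = h} λ i → quotient-as-count ua (1+ᶠ i) z<s (1+ᶠ≤ i))

-- The two symbols count the points (i, j) of the rectangle {1, ..., h} × {1, ..., g} on either side
-- of the line mj = ai. No point lies on the line, so together they count all hg points.
reciprocity : ∀ h g → Unit (suc (h ℕ.+ h)) (+ suc (g ℕ.+ g)) → Unit (suc (g ℕ.+ g)) (+ suc (h ℕ.+ h)) →
  Symbol.jacobi h (+ suc (g ℕ.+ g)) ℙ.+ Symbol.jacobi g (+ suc (h ℕ.+ h)) ≡ ℕ.parity h ℙ.* ℕ.parity g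
reciprocity h g ua um = begin
  Symbol.jacobi h (+ a) ℙ.+ Symbol.jacobi g (+ m)
    ≡⟨ cong₂ ℙ._+_ (jacobi-as-count h g ua)
         (trans (jacobi-as-count g h um) (∑-comm {m = g} {n = h} λ j i → above i j)) ⟩
  sum {h} (λ i → sum {g} (below i)) ℙ.+ sum {h} (λ i → sum {g} (above i))
    ≡⟨ ∑-distrib-+ {n = h} (λ i → sum {g} (below i)) (λ i → sum {g} (above i)) ⟨
  sum {h} (λ i → sum {g} (below i) ℙ.+ sum {g} (above i))
    ≡⟨ (sum-cong-≗ {n = h} λ i → trans (sym (∑-distrib-+ {n = g} (below i) (above i)))
         (trans (sum-cong-≗ {n = g} λ j → trichotomy i j) (sum-const g 1ℙ))) ⟩
  sum {h} (λ i → ℕ.parity g ℙ.* 1ℙ)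
    ≡⟨ sum-const h (ℕ.parity g ℙ.* 1ℙ) ⟩
  ℕ.parity h ℙ.* (ℕ.parity g ℙ.* 1ℙ)
    ≡⟨ cong (ℕ.parity h ℙ.*_) (ℙ.*-identityʳ (ℕ.parity g)) ⟩
  ℕ.parity h ℙ.* ℕ.parity g ∎
  where
  open ≡-Reasoning
  m = suc (h ℕ.+ h)
  a = suc (g ℕ.+ g)
  below above : Fin h → Fin g → Parity
  below i j = indicator (m ℕ.* 1+ᶠ j ℕ.<ᵇ a ℕ.* 1+ᶠ i)
  above i j = indicator (a ℕ.* 1+ᶠ i ℕ.<ᵇ m ℕ.* 1+ᶠ j)
  indicator-trichotomy : ∀ x y → x ≢ y → indicator (x ℕ.<ᵇ y) ℙ.+ indicator (y ℕ.<ᵇ x) ≡ 1ℙ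
  indicator-trichotomy zero    zero    x≢y = contradiction refl x≢y
  indicator-trichotomy zero    (suc y) x≢y = refl
  indicator-trichotomy (suc x) zero    x≢y = refl
  indicator-trichotomy (suc x) (suc y) x≢y = indicator-trichotomy x y (λ x≡y → x≢y (cong suc x≡y))
  trichotomy : ∀ i j → below i j ℙ.+ above i j ≡ 1ℙ
  trichotomy i j = indicator-trichotomy _ _ λ mj≡ai →
    Symbol.unit-≢0 h (1+ᶠ i) ua z<s (1+ᶠ≤ i) (congruent (+ 1+ᶠ j) (trans (sym (ℤ.pos-* a (1+ᶠ i)))
      (trans (cong +_ (trans (sym mj≡ai) (ℕ.*-comm m (1+ᶠ j))))
        (trans (ℤ.pos-* (1+ᶠ j) m) (sym (ℤ.+-identityˡ _))))))

-- Parities, powers of two and residues modulo 8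

even⇒double : ∀ n → ℕ.parity n ≡ 0ℙ → ∃ λ k → n ≡ k ℕ.+ k
even⇒double zero          _ = 0 , refl
even⇒double (suc (suc n)) p =
  let k , n≡k+k = even⇒double n p in suc k , cong suc (trans (cong suc n≡k+k) (sym (ℕ.+-suc k k)))

odd⇒1+double : ∀ n → ℕ.parity n ≡ 1ℙ → ∃ λ k → n ≡ suc (k ℕ.+ k)
odd⇒1+double (suc zero)    _ = 0 , refl
odd⇒1+double (suc (suc n)) p =
  let k , n≡1+k+k = odd⇒1+double n p in suc k , cong suc (trans (cong suc n≡1+k+k) (cong suc (sym (ℕ.+-suc k k))))

even⇒2∣ : ∀ n → ℕ.parity n ≡ 0ℙ → 2 ∣ n
even⇒2∣ n p = let k , n≡k+k = even⇒double n p in divides k (trans n≡k+k (lemma k))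
  where
  lemma : ∀ k → k ℕ.+ k ≡ k ℕ.* 2
  lemma = ℕ-Solver.solve-∀

parity-^ : ∀ a k → 0 < k → ℕ.parity (a ℕ.^ k) ≡ ℕ.parity a
parity-^ a (suc zero)    _ = cong ℕ.parity (ℕ.*-identityʳ a)
parity-^ a (suc (suc k)) _ = trans (ℙ.*-homo-* a (a ℕ.^ suc k))
  (trans (cong (ℕ.parity a ℙ.*_) (parity-^ a (suc k) z<s)) (ℙ.*-idem (ℕ.parity a)))

pos-^ : ∀ a k → + (a ℕ.^ k) ≡ (+ a) ℤ.^ k
pos-^ a zero    = refl
pos-^ a (suc k) = trans (ℤ.pos-* a (a ℕ.^ k)) (cong (+ a ℤ.*_) (pos-^ a k))

^-injectiveˡ : ∀ {a b} k .{{_ : ℕ.NonZero k}} → a ℕ.^ k ≡ b ℕ.^ k → a ≡ b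
^-injectiveˡ {a} {b} k eq with ℕ.<-cmp a b
... | tri< a<b _ _ = contradiction eq (ℕ.<⇒≢ (ℕ.^-monoˡ-< k a<b))
... | tri≈ _ a≡b _ = a≡b
... | tri> _ _ b<a = contradiction (sym eq) (ℕ.<⇒≢ (ℕ.^-monoˡ-< k b<a))

∣-^ : ∀ {a b} k → a ∣ b → a ℕ.^ k ∣ b ℕ.^ k
∣-^ zero    a∣b = ∣-refl
∣-^ (suc k) a∣b = *-pres-∣ a∣b (∣-^ k a∣b)

k<2^k : ∀ k → k < 2 ℕ.^ k
k<2^k zero    = z<s
k<2^k (suc k) = begin-strict
  suc k                             ≤⟨ k<2^k k ⟩
  2 ℕ.^ k                           <⟨ ℕ.m<m+n (2 ℕ.^ k) (ℕ.m^n>0 2 k) ⟩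
  2 ℕ.^ k ℕ.+ 2 ℕ.^ k               ≡⟨ cong (2 ℕ.^ k ℕ.+_) (ℕ.+-identityʳ (2 ℕ.^ k)) ⟨
  2 ℕ.^ suc k                       ∎
  where open ℕ.≤-Reasoning

-- The common power of two in a pair of exponents.

Reduced : ℕ → ℕ → Set
Reduced x w = ∃ λ k → ∃ λ x′ → ∃ λ w′ →
  x ≡ x′ ℕ.* 2 ℕ.^ k × w ≡ w′ ℕ.* 2 ℕ.^ k × (ℕ.parity x′ ≡ 1ℙ ⊎ ℕ.parity w′ ≡ 1ℙ)

-- Strong induction on x: as long as both numbers are even, halve both. The descent ends because x
-- is positive.
reduce : ∀ x w → 0 < x → Reduced x w
reduce = <-rec (λ x → ∀ w → 0 < x → Reduced x w) step
  where
  double : ∀ a b c d → a ≡ b ℕ.+ b → b ≡ c ℕ.* d → a ≡ c ℕ.* (2 ℕ.* d)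
  double a b c d refl refl = lemma c d
    where
    lemma : ∀ c d → c ℕ.* d ℕ.+ c ℕ.* d ≡ c ℕ.* (2 ℕ.* d)
    lemma = ℕ-Solver.solve-∀
  step : ∀ x → (∀ {a} → a < x → ∀ w → 0 < a → Reduced a w) → ∀ w → 0 < x → Reduced x w
  step x rec w 0<x with ℕ.parity x in px | ℕ.parity w in pw
  ... | 1ℙ | _  = 0 , x , w , sym (ℕ.*-identityʳ x) , sym (ℕ.*-identityʳ w) , inj₁ px
  ... | 0ℙ | 1ℙ = 0 , x , w , sym (ℕ.*-identityʳ x) , sym (ℕ.*-identityʳ w) , inj₂ pw
  ... | 0ℙ | 0ℙ with even⇒double x px | even⇒double w pw
  ...   | zero  , refl | b , _ = contradiction 0<x λ ()
  ...   | suc a , x≡ | b , w≡ =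
    let k , x′ , w′ , a≡ , b≡ , odd = rec (subst (suc a <_) (sym x≡) (ℕ.m<m+n (suc a) z<s)) b z<s
    in suc k , x′ , w′ , double x (suc a) x′ (2 ℕ.^ k) x≡ a≡ , double w b w′ (2 ℕ.^ k) w≡ b≡ , odd

∣⇒≡0 : ∀ {m a} → m ∣ a → + a ≋ 0ℤ [mod m ]
∣⇒≡0 {m} (divides q a≡qm) =
  congruent (+ q) (trans (cong +_ a≡qm) (trans (ℤ.pos-* q m) (sym (ℤ.+-identityˡ _))))

%⇒≡ : ∀ a m .{{_ : ℕ.NonZero m}} → + a ≋ + (a ℕ.% m) [mod m ]
%⇒≡ a m = congruent (+ (a ℕ./ m)) (trans (cong +_ (ℕ.m≡m%n+[m/n]*n a m))
  (cong (λ t → + (a ℕ.% m) ℤ.+ t) (ℤ.pos-* (a ℕ./ m) m)))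

≢-mod : ∀ {m a b} → a < m → b < m → a ≢ b → ¬ (+ a ≋ + b [mod m ])
≢-mod a<m b<m a≢b a≡b = a≢b (mod-injective a<m b<m a≡b)

≢-mod-8 : ∀ {a b} {_ : T (a ℕ.<ᵇ 8)} {_ : T (b ℕ.<ᵇ 8)} → a ≢ b → ¬ (+ a ≋ + b [mod 8 ])
≢-mod-8 {a} {b} {a<8} {b<8} = ≢-mod (ℕ.<ᵇ⇒< a 8 a<8) (ℕ.<ᵇ⇒< b 8 b<8)

-- Odd numbers square to 1 modulo 8, so their powers depend only on the parity of the exponent. This
-- lemma and the next are the two cases.
involution-^-even : ∀ {m a} k → a ℤ.* a ≋ 1ℤ [mod m ] → ℕ.parity k ≡ 0ℙ → a ℤ.^ k ≋ 1ℤ [mod m ]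
involution-^-even zero _ _ = mod-refl
involution-^-even {a = a} (suc (suc k)) aa≡1 p = mod-trans (mod-reflexive (sym (ℤ.*-assoc a a (a ℤ.^ k))))
  (mod-* aa≡1 (involution-^-even k aa≡1 p))

involution-^-odd : ∀ {m a} k → a ℤ.* a ≋ 1ℤ [mod m ] → ℕ.parity k ≡ 1ℙ → a ℤ.^ k ≋ a [mod m ]
involution-^-odd {a = a} (suc zero) _ _ = mod-reflexive (ℤ.*-identityʳ a)
involution-^-odd {a = a} (suc (suc k)) aa≡1 p = mod-trans (mod-reflexive (sym (ℤ.*-assoc a a (a ℤ.^ k))))
  (mod-trans (mod-* aa≡1 (involution-^-odd k aa≡1 p)) (mod-reflexive (ℤ.*-identityˡ a)))

pronic-even : ∀ j → ∃ λ t → j ℕ.* suc j ≡ t ℕ.+ t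
pronic-even j = even⇒double (j ℕ.* suc j) (trans (ℙ.*-homo-* j (suc j)) (lemma (ℕ.parity j) (ℙ.+-homo-+ 1 j)))
  where
  lemma : ∀ p {q} → q ≡ 1ℙ ℙ.+ p → p ℙ.* q ≡ 0ℙ
  lemma 0ℙ _    = refl
  lemma 1ℙ refl = refl

-- (2j + 1)² = 1 + 4j(j + 1), and j(j + 1) is even.
odd-square : ∀ a → ℕ.parity a ≡ 1ℙ → ∃ λ t → a ℕ.* a ≡ 1 ℕ.+ t ℕ.* 8
odd-square a a-odd with odd⇒1+double a a-odd
... | j , refl with pronic-even j
... | t , jj≡ = t , trans (lemma j) (trans (cong (λ s → 1 ℕ.+ s ℕ.* 4) jj≡) (lemma′ t))
  where
  lemma : ∀ j → suc (j ℕ.+ j) ℕ.* suc (j ℕ.+ j) ≡ 1 ℕ.+ (j ℕ.* suc j) ℕ.* 4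
  lemma = ℕ-Solver.solve-∀
  lemma′ : ∀ t → 1 ℕ.+ (t ℕ.+ t) ℕ.* 4 ≡ 1 ℕ.+ t ℕ.* 8
  lemma′ = ℕ-Solver.solve-∀

odd-involution-mod-8 : ∀ a → ℕ.parity a ≡ 1ℙ → + a ℤ.* + a ≋ 1ℤ [mod 8 ]
odd-involution-mod-8 a a-odd = let t , aa≡ = odd-square a a-odd in
  congruent (+ t) (trans (sym (ℤ.pos-* a a)) (trans (cong +_ aa≡) (cong (λ s → 1ℤ ℤ.+ s) (ℤ.pos-* t 8))))

-- The supplementary law for 2 by residues modulo 8.

triangular-parity-mod-8 : ∀ g → ∃ λ r → r < 4 ×
  Symbol.triangular-parity g ≡ Symbol.triangular-parity r × + suc (g ℕ.+ g) ≋ + suc (r ℕ.+ r) [mod 8 ]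
triangular-parity-mod-8 0 = 0 , s≤s z≤n , refl , mod-refl
triangular-parity-mod-8 1 = 1 , s≤s (s≤s z≤n) , refl , mod-refl
triangular-parity-mod-8 2 = 2 , s≤s (s≤s (s≤s z≤n)) , refl , mod-refl
triangular-parity-mod-8 3 = 3 , s≤s (s≤s (s≤s (s≤s z≤n))) , refl , mod-refl
triangular-parity-mod-8 (suc (suc (suc (suc g)))) =
  let r , r<4 , sum≡ , g≡r = triangular-parity-mod-8 g in
  -- The first four terms have parities 1, 0, 1, 0 and so invert the sum twice; shifting the other
  -- terms by four keeps their parities. Meanwhile 2g + 1 grows by 8.
  r , r<4 , trans (ℙ.⁻¹-involutive _) sum≡ , mod-trans (congruent 1ℤ (cong +_ (lemma g))) g≡r
  where
  lemma : ∀ g → suc (4 ℕ.+ g ℕ.+ (4 ℕ.+ g)) ≡ suc (g ℕ.+ g) ℕ.+ 8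
  lemma = ℕ-Solver.solve-∀

triangular-parity-±1 : ∀ g → (+ suc (g ℕ.+ g) ≋ + 1 [mod 8 ] ⊎ + suc (g ℕ.+ g) ≋ + 7 [mod 8 ]) →
  Symbol.triangular-parity g ≡ 0ℙ
triangular-parity-±1 g g≡ with triangular-parity-mod-8 g
... | 0 , _ , sum≡ , _ = sum≡
... | 3 , _ , sum≡ , _ = sum≡
... | 1 , _ , sum≡ , g≡3 with g≡
...   | inj₁ g≡1 = contradiction (mod-trans (mod-sym g≡3) g≡1) (≢-mod-8 λ ())
...   | inj₂ g≡7 = contradiction (mod-trans (mod-sym g≡3) g≡7) (≢-mod-8 λ ())
triangular-parity-±1 g g≡ | 2 , _ , sum≡ , g≡5 with g≡
...   | inj₁ g≡1 = contradiction (mod-trans (mod-sym g≡5) g≡1) (≢-mod-8 λ ())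
...   | inj₂ g≡7 = contradiction (mod-trans (mod-sym g≡5) g≡7) (≢-mod-8 λ ())
triangular-parity-±1 g g≡ | suc (suc (suc (suc r))) , s≤s (s≤s (s≤s (s≤s ()))) , _

triangular-parity-±3 : ∀ g → (+ suc (g ℕ.+ g) ≋ + 3 [mod 8 ] ⊎ + suc (g ℕ.+ g) ≋ + 5 [mod 8 ]) →
  Symbol.triangular-parity g ≡ 1ℙ
triangular-parity-±3 g g≡ with triangular-parity-mod-8 g
... | 1 , _ , sum≡ , _ = sum≡
... | 2 , _ , sum≡ , _ = sum≡
... | 0 , _ , sum≡ , g≡1 with g≡
...   | inj₁ g≡3 = contradiction (mod-trans (mod-sym g≡1) g≡3) (≢-mod-8 λ ())
...   | inj₂ g≡5 = contradiction (mod-trans (mod-sym g≡1) g≡5) (≢-mod-8 λ ())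
triangular-parity-±3 g g≡ | 3 , _ , sum≡ , g≡7 with g≡
...   | inj₁ g≡3 = contradiction (mod-trans (mod-sym g≡7) g≡3) (≢-mod-8 λ ())
...   | inj₂ g≡5 = contradiction (mod-trans (mod-sym g≡7) g≡5) (≢-mod-8 λ ())
triangular-parity-±3 g g≡ | suc (suc (suc (suc r))) , s≤s (s≤s (s≤s (s≤s ()))) , _

-- For a divisor d of m - 8 the symbol of d modulo m is, by reciprocity, that of 8 modulo d.
module _ (h g v : ℕ) (h-even : ℕ.parity h ≡ 0ℙ)
         (m≡vd+8 : suc (h ℕ.+ h) ≡ v ℕ.* suc (g ℕ.+ g) ℕ.+ 8) where

  private
    m d : ℕ
    m = suc (h ℕ.+ h)
    d = suc (g ℕ.+ g)

    m≡8 : + m ≋ (+ 2) ℤ.^ 3 [mod d ]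
    m≡8 = congruent (+ v) (trans (cong +_ (trans m≡vd+8 (ℕ.+-comm (v ℕ.* d) 8)))
      (cong (λ t → + 8 ℤ.+ t) (ℤ.pos-* v d)))

    vd≡-8 : + v ℤ.* + d ≋ -1ℤ ℤ.* (+ 2) ℤ.^ 3 [mod m ]
    vd≡-8 = congruent 1ℤ (trans (sym (ℤ.pos-* v d)) (trans (lemma (+ (v ℕ.* d)))
      (cong (λ t → -1ℤ ℤ.* (+ 2) ℤ.^ 3 ℤ.+ 1ℤ ℤ.* t) (cong +_ (sym m≡vd+8)))))
      where
      lemma : ∀ x → x ≡ -1ℤ ℤ.* (+ 2) ℤ.^ 3 ℤ.+ 1ℤ ℤ.* (x ℤ.+ + 8)
      lemma = ℤ-Solver.solve-∀

  -- d divides vd ≡ -8, which is invertible modulo the odd number m.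
  unit-divisor : Unit m (+ d)
  unit-divisor = unit-*ʳ (+ v) (+ d) (unit-≡ vd≡-8 (unit-* {a = -1ℤ} {b = (+ 2) ℤ.^ 3} (unit -1ℤ mod-refl) (unit-^ {a = + 2} 3 (Symbol.unit-2 h))))

  jacobi-divisor : Symbol.jacobi h (+ d) ≡ Symbol.triangular-parity g
  jacobi-divisor = trans (opposite _ _ (trans
      (reciprocity h g unit-divisor (unit-≡ m≡8 (unit-^ 3 (Symbol.unit-2 g))))
      -- For even h, that is m ≡ 1 (mod 4), the sign in the reciprocity law is trivial.
      (cong (ℙ._* ℕ.parity g) h-even)))
    (trans (Symbol.jacobi-cong g (unit-^ 3 (Symbol.unit-2 g)) m≡8)
    (trans (Symbol.jacobi-^ g 3 (Symbol.unit-2 g)) (Symbol.jacobi-2 g)))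
    where
    opposite : ∀ p q → p ℙ.+ q ≡ 0ℙ → p ≡ q
    opposite 0ℙ 0ℙ _ = refl
    opposite 1ℙ 1ℙ _ = refl

-- Two-adic behaviour of 2ᵏ-th powers.

square-lift : ∀ {a} c r → a ≋ 1ℤ ℤ.+ c ℤ.* + (4 ℕ.* r) [mod 8 ℕ.* r ] →
  a ℤ.* a ≋ 1ℤ ℤ.+ c ℤ.* + (4 ℕ.* (2 ℕ.* r)) [mod 8 ℕ.* (2 ℕ.* r) ]
square-lift {a} c r (congruent q a≡) =
  -- With a = 1 + 4r(c + 2q) the square is 1 + 8rc + 16r(q + r(c + 2q)²): the step 4r and the
  -- modulus 8r both double while c survives.
  congruent (q ℤ.+ + r ℤ.* (c ℤ.+ + 2 ℤ.* q) ℤ.* (c ℤ.+ + 2 ℤ.* q)) (begin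
    a ℤ.* a
      ≡⟨ cong (λ s → s ℤ.* s) (trans a≡ (cong₂ (λ s t → 1ℤ ℤ.+ c ℤ.* s ℤ.+ q ℤ.* t) (ℤ.pos-* 4 r) (ℤ.pos-* 8 r))) ⟩
    (1ℤ ℤ.+ c ℤ.* (+ 4 ℤ.* + r) ℤ.+ q ℤ.* (+ 8 ℤ.* + r)) ℤ.* (1ℤ ℤ.+ c ℤ.* (+ 4 ℤ.* + r) ℤ.+ q ℤ.* (+ 8 ℤ.* + r))
      ≡⟨ lemma c q (+ r) ⟩
    1ℤ ℤ.+ c ℤ.* (+ 4 ℤ.* (+ 2 ℤ.* + r)) ℤ.+ Q ℤ.* (+ 8 ℤ.* (+ 2 ℤ.* + r))
      ≡⟨ cong₂ (λ s t → 1ℤ ℤ.+ c ℤ.* s ℤ.+ Q ℤ.* t) (cast 4) (cast 8) ⟨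
    1ℤ ℤ.+ c ℤ.* + (4 ℕ.* (2 ℕ.* r)) ℤ.+ Q ℤ.* + (8 ℕ.* (2 ℕ.* r)) ∎)
  where
  open ≡-Reasoning
  Q = q ℤ.+ + r ℤ.* (c ℤ.+ + 2 ℤ.* q) ℤ.* (c ℤ.+ + 2 ℤ.* q)
  cast : ∀ k → + (k ℕ.* (2 ℕ.* r)) ≡ + k ℤ.* (+ 2 ℤ.* + r)
  cast k = trans (ℤ.pos-* k (2 ℕ.* r)) (cong (+ k ℤ.*_) (ℤ.pos-* 2 r))
  lemma : ∀ c q r →
    (1ℤ ℤ.+ c ℤ.* (+ 4 ℤ.* r) ℤ.+ q ℤ.* (+ 8 ℤ.* r)) ℤ.* (1ℤ ℤ.+ c ℤ.* (+ 4 ℤ.* r) ℤ.+ q ℤ.* (+ 8 ℤ.* r)) ≡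
    1ℤ ℤ.+ c ℤ.* (+ 4 ℤ.* (+ 2 ℤ.* r)) ℤ.+
      (q ℤ.+ r ℤ.* (c ℤ.+ + 2 ℤ.* q) ℤ.* (c ℤ.+ + 2 ℤ.* q)) ℤ.* (+ 8 ℤ.* (+ 2 ℤ.* r))
  lemma = ℤ-Solver.solve-∀

^-2^-lift : ∀ {a} c k → a ≋ 1ℤ ℤ.+ c ℤ.* + 4 [mod 8 ] →
  a ℤ.^ (2 ℕ.^ k) ≋ 1ℤ ℤ.+ c ℤ.* + (4 ℕ.* 2 ℕ.^ k) [mod 8 ℕ.* 2 ℕ.^ k ]
^-2^-lift {a} c zero    a≡ = mod-trans (mod-reflexive (ℤ.*-identityʳ a)) a≡
^-2^-lift {a} c (suc k) a≡ = mod-trans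
  (mod-reflexive (trans (cong (λ e → a ℤ.^ (2 ℕ.^ k ℕ.+ e)) (ℕ.+-identityʳ (2 ℕ.^ k)))
    (ℤ.^-distribˡ-+-* a (2 ℕ.^ k) (2 ℕ.^ k))))
  (square-lift c (2 ℕ.^ k) (^-2^-lift c k a≡))

-- In `^-2^-lift` the residue 5 is c = 1 and the residue 1 is c = 0. With r = 2ᵏ the two powers are
-- therefore 1 + 4r and 1 modulo 8r, which are different remainders.
^-2^-distinct : ∀ {a b} k → a ≋ + 5 [mod 8 ] → b ≋ 1ℤ [mod 8 ] →
  ¬ (a ℤ.^ (2 ℕ.^ k) ≋ b ℤ.^ (2 ℕ.^ k) [mod 8 ℕ.* 2 ℕ.^ k ])
^-2^-distinct k a≡5 b≡1 a≡b = ≢-mod 1+4r<8r 1<8r (λ 1+4r≡1 → ℕ.<⇒≢ 0<4r (sym (ℕ.suc-injective 1+4r≡1)))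
  (mod-trans (mod-reflexive (cong (λ t → 1ℤ ℤ.+ t) (sym (ℤ.*-identityˡ (+ (4 ℕ.* r))))))
  (mod-trans (mod-sym (^-2^-lift 1ℤ k a≡5))
  (mod-trans a≡b (^-2^-lift 0ℤ k b≡1))))
  where
  open ℕ.≤-Reasoning
  r = 2 ℕ.^ k
  0<4r : 0 < 4 ℕ.* r
  0<4r = ℕ.*-monoʳ-< 4 (ℕ.m^n>0 2 k)
  1<4r : 1 < 4 ℕ.* r
  1<4r = ℕ.≤-trans (s≤s (s≤s z≤n)) (ℕ.*-monoʳ-≤ 4 (ℕ.m^n>0 2 k))
  8r≡ : 4 ℕ.* r ℕ.+ 4 ℕ.* r ≡ 8 ℕ.* r
  8r≡ = sym (ℕ.*-distribʳ-+ r 4 4)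
  1+4r<8r : suc (4 ℕ.* r) < 8 ℕ.* r
  1+4r<8r = subst (suc (4 ℕ.* r) <_) 8r≡ (ℕ.+-monoˡ-< (4 ℕ.* r) 1<4r)
  1<8r : 1 < 8 ℕ.* r
  1<8r = ℕ.≤-trans 1<4r (subst (4 ℕ.* r ≤_) 8r≡ (ℕ.m≤m+n _ _))

-- 4ʸ = 2²ʸ divides the power, and 2y ≥ k + 3.
8*2^k∣ : ∀ u k y → suc (suc k) ≤ y → 8 ℕ.* 2 ℕ.^ k ∣ (4 ℕ.* u) ℕ.^ y
8*2^k∣ u k y 2+k≤y = ∣-trans (divides (2 ℕ.^ e) (begin
    4 ℕ.^ y                           ≡⟨ ℕ.^-*-assoc 2 2 y ⟩
    2 ℕ.^ (2 ℕ.* y)                   ≡⟨ cong (2 ℕ.^_) (sym (ℕ.m∸n+n≡m 3+k≤2y)) ⟩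
    2 ℕ.^ (e ℕ.+ (3 ℕ.+ k))           ≡⟨ ℕ.^-distribˡ-+-* 2 e (3 ℕ.+ k) ⟩
    2 ℕ.^ e ℕ.* 2 ℕ.^ (3 ℕ.+ k)       ≡⟨ cong (2 ℕ.^ e ℕ.*_) (ℕ.^-distribˡ-+-* 2 3 k) ⟩
    2 ℕ.^ e ℕ.* (8 ℕ.* 2 ℕ.^ k)       ∎))
  (∣-^ y (m∣m*n u))
  where
  open ≡-Reasoning
  e = 2 ℕ.* y ℕ.∸ (3 ℕ.+ k)
  3+k≤2y : 3 ℕ.+ k ≤ 2 ℕ.* y
  3+k≤2y = ℕ.≤-trans (ℕ.+-mono-≤ {1} {y} (ℕ.≤-trans (s≤s z≤n) 2+k≤y) 2+k≤y)
    (ℕ.≤-reflexive (cong (y ℕ.+_) (sym (ℕ.+-identityʳ y))))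

-- The equation

module _ {u x y z n u₁ u₂ : ℕ}
  (u-odd : ℕ.parity u ≡ 1ℙ) (0<x : 0 < x) (x<z : x < z) (z<y : z < y)
  (u₁u₂≡ : u ℕ.* u ℕ.+ 4 ≡ u₁ ℕ.* u₂ ℕ.+ 8)
  (equation : (u ℕ.* u ℕ.+ 4) ℕ.^ z ≡ (4 ℕ.* u) ℕ.^ y ℕ.* n ℕ.^ (y ℕ.∸ z) ℕ.+ u₁ ℕ.^ x)
  (n^≡u₂^ : n ℕ.^ (z ℕ.∸ x) ≡ u₂ ℕ.^ x)
  (u₁≡±1 : + u₁ ≋ + 1 [mod 8 ] ⊎ + u₁ ≋ + 7 [mod 8 ])
  where

  private
    U : ℕ
    U = u ℕ.* u ℕ.+ 4

    halve-U : ∃ λ h → U ≡ suc (h ℕ.+ h) × ℕ.parity h ≡ 0ℙ × + U ≋ + 5 [mod 8 ]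
    halve-U = let t , u²≡1+8t = odd-square u u-odd in
      -- From u² = 1 + 8t one gets U = 8t + 5, hence h = 4t + 2.
      2 ℕ.+ (t ℕ.+ t) ℕ.+ (t ℕ.+ t) ,
      trans (cong (ℕ._+ 4) u²≡1+8t) (lemma t) ,
      trans (ℙ.+-homo-+ (t ℕ.+ t) (t ℕ.+ t)) (ℙ.p+p≡0ℙ (ℕ.parity (t ℕ.+ t))) ,
      congruent (+ t) (trans (cong (λ s → + (s ℕ.+ 4)) u²≡1+8t)
        (trans (cong +_ (ℕ.+-comm (1 ℕ.+ t ℕ.* 8) 4)) (cong (λ s → + 5 ℤ.+ s) (ℤ.pos-* t 8))))
      where
      lemma : ∀ t → 1 ℕ.+ t ℕ.* 8 ℕ.+ 4 ≡
        suc (2 ℕ.+ (t ℕ.+ t) ℕ.+ (t ℕ.+ t) ℕ.+ (2 ℕ.+ (t ℕ.+ t) ℕ.+ (t ℕ.+ t)))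
      lemma = ℕ-Solver.solve-∀

    U≡5 : + U ≋ + 5 [mod 8 ]
    U≡5 = proj₂ (proj₂ (proj₂ halve-U))

    U-odd : ℕ.parity U ≡ 1ℙ
    U-odd = trans (ℙ.+-homo-+ (u ℕ.* u) 4) (trans (ℙ.+-identityʳ _)
      (trans (ℙ.*-homo-* u u) (cong₂ ℙ._*_ u-odd u-odd)))

    u₁u₂-odd : ℕ.parity u₁ ℙ.* ℕ.parity u₂ ≡ 1ℙ
    u₁u₂-odd = trans (sym (ℙ.*-homo-* u₁ u₂)) (trans (sym (ℙ.+-identityʳ _))
      (trans (sym (ℙ.+-homo-+ (u₁ ℕ.* u₂) 8)) (trans (cong ℕ.parity (sym u₁u₂≡)) U-odd)))

    factors-odd : ∀ {p q} → p ℙ.* q ≡ 1ℙ → p ≡ 1ℙ × q ≡ 1ℙ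
    factors-odd {1ℙ} {1ℙ} _ = refl , refl

    u₁-odd : ℕ.parity u₁ ≡ 1ℙ
    u₁-odd = proj₁ (factors-odd u₁u₂-odd)

    u₂-odd : ℕ.parity u₂ ≡ 1ℙ
    u₂-odd = proj₂ (factors-odd {ℕ.parity u₁} u₁u₂-odd)

    n-odd : ℕ.parity n ≡ 1ℙ
    n-odd = trans (sym (parity-^ n (z ℕ.∸ x) (ℕ.m<n⇒0<n∸m x<z)))
      (trans (cong ℕ.parity n^≡u₂^) (trans (parity-^ u₂ x 0<x) u₂-odd))

    u₁u₂≡5 : + u₁ ℤ.* + u₂ ≋ + 5 [mod 8 ]
    u₁u₂≡5 = mod-trans (congruent -1ℤ (trans (sym (ℤ.pos-* u₁ u₂)) (lemma (+ (u₁ ℕ.* u₂)))))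
      (subst (λ V → + V ≋ + 5 [mod 8 ]) u₁u₂≡ U≡5)
      where
      lemma : ∀ a → a ≡ (a ℤ.+ + 8) ℤ.+ -1ℤ ℤ.* + 8
      lemma = ℤ-Solver.solve-∀

    -- The odd number u₁ is its own inverse modulo 8, so it can be moved across u₁u₂ ≡ 5.
    u₂≡5u₁ : + u₂ ≋ + u₁ ℤ.* + 5 [mod 8 ]
    u₂≡5u₁ = mod-trans (mod-reflexive (sym (ℤ.*-identityˡ (+ u₂))))
      (mod-trans (mod-* (mod-sym (odd-involution-mod-8 u₁ u₁-odd)) mod-refl)
      (mod-trans (mod-reflexive (ℤ.*-assoc (+ u₁) (+ u₁) (+ u₂))) (mod-* (mod-refl {x = + u₁}) u₁u₂≡5)))

    u₂≡±3 : + u₂ ≋ + 3 [mod 8 ] ⊎ + u₂ ≋ + 5 [mod 8 ]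
    u₂≡±3 = [ (λ u₁≡1 → inj₂ (mod-trans u₂≡5u₁ (mod-* u₁≡1 mod-refl)))
            , (λ u₁≡7 → inj₁ (mod-trans u₂≡5u₁
                (mod-trans (mod-* u₁≡7 (mod-refl {x = + 5})) (congruent (+ 4) refl)))) ]′ u₁≡±1

    u₂≢1 : ¬ (+ u₂ ≋ 1ℤ [mod 8 ])
    u₂≢1 u₂≡1 with u₂≡±3
    ... | inj₁ u₂≡3 = ≢-mod-8 (λ ()) (mod-trans (mod-sym u₂≡3) u₂≡1)
    ... | inj₂ u₂≡5 = ≢-mod-8 (λ ()) (mod-trans (mod-sym u₂≡5) u₂≡1)

    equation-ℤ : (+ U) ℤ.^ z ≡ + ((4 ℕ.* u) ℕ.^ y) ℤ.* (+ n) ℤ.^ (y ℕ.∸ z) ℤ.+ (+ u₁) ℤ.^ x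
    equation-ℤ = trans (sym (pos-^ U z)) (trans (cong +_ equation)
      (cong₂ ℤ._+_ (trans (ℤ.pos-* ((4 ℕ.* u) ℕ.^ y) _) (cong (+ ((4 ℕ.* u) ℕ.^ y) ℤ.*_) (pos-^ n (y ℕ.∸ z)))) (pos-^ u₁ x)))

    -- The remaining term of the equation contains (4u)ʸ, a multiple of 8·2ᵏ for such y.
    U^z≡u₁^x : ∀ k → suc (suc k) ≤ y → (+ U) ℤ.^ z ≋ (+ u₁) ℤ.^ x [mod 8 ℕ.* 2 ℕ.^ k ]
    U^z≡u₁^x k 2+k≤y = mod-trans (mod-reflexive equation-ℤ) (mod-trans
      (mod-+ (mod-* (∣⇒≡0 (8*2^k∣ u k y 2+k≤y)) (mod-refl {x = (+ n) ℤ.^ (y ℕ.∸ z)})) (mod-refl {x = (+ u₁) ℤ.^ x}))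
      (mod-reflexive (ℤ.+-identityˡ _)))

    U²≡1 : + U ℤ.* + U ≋ 1ℤ [mod 8 ]
    U²≡1 = odd-involution-mod-8 U U-odd

    u₁≢5 : ¬ (+ u₁ ≋ + 5 [mod 8 ])
    u₁≢5 u₁≡5 = [ (λ u₁≡1 → ≢-mod-8 (λ ()) (mod-trans (mod-sym u₁≡1) u₁≡5))
                , (λ u₁≡7 → ≢-mod-8 (λ ()) (mod-trans (mod-sym u₁≡7) u₁≡5)) ]′ u₁≡±1

    u₁^x≢5 : ¬ ((+ u₁) ℤ.^ x ≋ + 5 [mod 8 ])
    u₁^x≢5 u₁^x≡5 with ℕ.parity x in px
    ... | 0ℙ = ≢-mod-8 (λ ()) (mod-trans (mod-sym
      (involution-^-even x (odd-involution-mod-8 u₁ u₁-odd) px)) u₁^x≡5)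
    ... | 1ℙ = u₁≢5 (mod-trans (mod-sym
      (involution-^-odd x (odd-involution-mod-8 u₁ u₁-odd) px)) u₁^x≡5)

    -- For odd z one has Uᶻ ≡ U ≡ 5 (mod 8), whereas a power of u₁ is congruent to 1 or to u₁, never
    -- to 5.
    z-even : ℕ.parity z ≡ 0ℙ
    z-even with ℕ.parity z in pz
    ... | 0ℙ = refl
    ... | 1ℙ = contradiction (mod-trans (mod-sym (U^z≡u₁^x 0 (ℕ.≤-trans (s≤s (ℕ.<-trans 0<x x<z)) z<y)))
      (mod-trans (involution-^-odd z U²≡1 pz) U≡5)) u₁^x≢5

    z≡x+[z∸x] : z ≡ x ℕ.+ (z ℕ.∸ x)
    z≡x+[z∸x] = sym (ℕ.m+[n∸m]≡n (ℕ.<⇒≤ x<z))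

    square-case : ∀ x′ w → n ℕ.^ w ≡ u₂ ℕ.^ x′ → ¬ (ℕ.parity w ≡ 0ℙ × ℕ.parity x′ ≡ 1ℙ)
    square-case x′ w n^w≡ (w-even , x′-odd) = u₂≢1
      (mod-trans (mod-sym (involution-^-odd x′ (odd-involution-mod-8 u₂ u₂-odd) x′-odd))
      (mod-trans (mod-reflexive (trans (sym (pos-^ u₂ x′)) (trans (cong +_ (sym n^w≡)) (pos-^ n w))))
      (involution-^-even w (odd-involution-mod-8 n n-odd) w-even)))

    2-adic-case : ∀ k x′ w → x ≡ x′ ℕ.* 2 ℕ.^ k → z ℕ.∸ x ≡ w ℕ.* 2 ℕ.^ k →
      ¬ (ℕ.parity w ≡ 1ℙ × ℕ.parity x′ ≡ 0ℙ)
    2-adic-case k x′ w x≡ z∸x≡ (w-odd , x′-even) = ^-2^-distinct k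
      (mod-trans (involution-^-odd z′ U²≡1 z′-odd) U≡5)
      (involution-^-even x′ (odd-involution-mod-8 u₁ u₁-odd) x′-even)
      (mod-trans (mod-reflexive (trans (ℤ.^-*-assoc (+ U) z′ (2 ℕ.^ k)) (cong ((+ U) ℤ.^_) (sym z≡))))
      (mod-trans (U^z≡u₁^x k 2+k≤y)
      (mod-reflexive (sym (trans (ℤ.^-*-assoc (+ u₁) x′ (2 ℕ.^ k)) (cong ((+ u₁) ℤ.^_) (sym x≡)))))))
      where
      z′ : ℕ
      -- The odd number z′ satisfies z = z′2ᵏ, so Uᶻ and u₁ˣ are the 2ᵏ-th powers of Uᶻ′ ≡ 5 and
      -- u₁ˣ′ ≡ 1 (mod 8).
      z′ = x′ ℕ.+ w
      z≡ : z ≡ z′ ℕ.* 2 ℕ.^ k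
      z≡ = trans z≡x+[z∸x] (trans (cong₂ ℕ._+_ x≡ z∸x≡) (sym (ℕ.*-distribʳ-+ (2 ℕ.^ k) x′ w)))
      z′-odd : ℕ.parity z′ ≡ 1ℙ
      z′-odd = trans (ℙ.+-homo-+ x′ w) (cong₂ ℙ._+_ x′-even w-odd)
      0<z′ : 0 < z′
      0<z′ = ℕ.n≢0⇒n>0 λ z′≡0 → contradiction (trans (sym (cong ℕ.parity z′≡0)) z′-odd) λ ()
      2+k≤y : suc (suc k) ≤ y
      -- The chain k < 2ᵏ ≤ z < y has two strict steps.
      2+k≤y = begin
        suc (suc k)           ≤⟨ s≤s (k<2^k k) ⟩
        suc (2 ℕ.^ k)         ≡⟨ cong suc (ℕ.*-identityˡ (2 ℕ.^ k)) ⟨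
        suc (1 ℕ.* 2 ℕ.^ k)   ≤⟨ s≤s (ℕ.*-monoˡ-≤ (2 ℕ.^ k) 0<z′) ⟩
        suc (z′ ℕ.* 2 ℕ.^ k)  ≡⟨ cong suc z≡ ⟨
        suc z                 ≤⟨ z<y ⟩
        y                     ∎
        where open ℕ.≤-Reasoning

    -- Jacobi symbols modulo U.

    module _ (h : ℕ) (U≡1+2h : U ≡ suc (h ℕ.+ h)) (h-even : ℕ.parity h ≡ 0ℙ) where

      open Symbol h using (m; jacobi; jacobi-*; jacobi-^; jacobi-cong; unit-2)

      divisor : ∀ a b → a ℕ.* b ≡ u₁ ℕ.* u₂ → ∀ g → b ≡ suc (g ℕ.+ g) →
        Unit m (+ b) × jacobi (+ b) ≡ Symbol.triangular-parity g
      divisor a b ab≡ g refl = unit-divisor h g a h-even m≡ , jacobi-divisor h g a h-even m≡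
        where
        m≡ : m ≡ a ℕ.* b ℕ.+ 8
        m≡ = trans (sym U≡1+2h) (trans u₁u₂≡ (cong (ℕ._+ 8) (sym ab≡)))

      u₁-symbol : Unit m (+ u₁) × jacobi (+ u₁) ≡ 0ℙ
      u₁-symbol with odd⇒1+double u₁ u₁-odd
      ... | g , u₁≡ with divisor u₂ u₁ (ℕ.*-comm u₂ u₁) g u₁≡
      ... | unit-u₁ , jacobi≡ = unit-u₁ , trans jacobi≡
        (triangular-parity-±1 g (subst (λ v → + v ≋ + 1 [mod 8 ] ⊎ + v ≋ + 7 [mod 8 ]) u₁≡ u₁≡±1))

      u₂-symbol : Unit m (+ u₂) × jacobi (+ u₂) ≡ 1ℙ
      u₂-symbol with odd⇒1+double u₂ u₂-odd
      ... | g , u₂≡ with divisor u₁ u₂ refl g u₂≡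
      ... | unit-u₂ , jacobi≡ = unit-u₂ , trans jacobi≡
        (triangular-parity-±3 g (subst (λ v → + v ≋ + 3 [mod 8 ] ⊎ + v ≋ + 5 [mod 8 ]) u₂≡ u₂≡±3))

      unit-u₁ : Unit m (+ u₁)
      unit-u₁ = proj₁ u₁-symbol

      unit-u₂ : Unit m (+ u₂)
      unit-u₂ = proj₁ u₂-symbol

      +m≡u²+4 : + m ≡ + u ℤ.* + u ℤ.+ + 4
      +m≡u²+4 = trans (cong +_ (sym U≡1+2h)) (cong (λ s → s ℤ.+ + 4) (ℤ.pos-* u u))

      unit-4 : Unit m (+ 4)
      unit-4 = unit-* unit-2 unit-2

      u²≡-4 : + u ℤ.* + u ≋ -1ℤ ℤ.* + 4 [mod m ]
      u²≡-4 = congruent 1ℤ (trans (lemma (+ u)) (cong (λ s → -1ℤ ℤ.* + 4 ℤ.+ 1ℤ ℤ.* s) (sym +m≡u²+4)))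
        where
        lemma : ∀ u → u ℤ.* u ≡ -1ℤ ℤ.* + 4 ℤ.+ 1ℤ ℤ.* (u ℤ.* u ℤ.+ + 4)
        lemma = ℤ-Solver.solve-∀

      unit-u : Unit m (+ u)
      unit-u = unit-*ˡ (+ u) (+ u) (unit-≡ u²≡-4 (unit-* {a = -1ℤ} {b = + 4} (unit -1ℤ mod-refl) unit-4))

      4u : ℤ
      4u = + (4 ℕ.* u)

      unit-4u : Unit m 4u
      unit-4u = subst (Unit m) (sym (ℤ.pos-* 4 u)) (unit-* {a = + 4} unit-4 unit-u)

      [u+2]²≡4u : (+ u ℤ.+ + 2) ℤ.* (+ u ℤ.+ + 2) ≋ 4u [mod m ]
      [u+2]²≡4u = congruent 1ℤ (trans (lemma (+ u)) (cong₂ (λ s t → s ℤ.+ 1ℤ ℤ.* t) (sym (ℤ.pos-* 4 u)) (sym +m≡u²+4)))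
        where
        lemma : ∀ u → (u ℤ.+ + 2) ℤ.* (u ℤ.+ + 2) ≡ + 4 ℤ.* u ℤ.+ 1ℤ ℤ.* (u ℤ.* u ℤ.+ + 4)
        lemma = ℤ-Solver.solve-∀

      jacobi-square : ∀ {a} → Unit m a → jacobi (a ℤ.* a) ≡ 0ℙ
      jacobi-square {a} ua = trans (jacobi-* ua ua) (ℙ.p+p≡0ℙ (jacobi a))

      jacobi-4u : jacobi 4u ≡ 0ℙ
      jacobi-4u = trans (sym (jacobi-cong unit-4u [u+2]²≡4u))
        (jacobi-square (unit-*ˡ (+ u ℤ.+ + 2) (+ u ℤ.+ + 2) (unit-≡ [u+2]²≡4u unit-4u)))

      unit-n : Unit m (+ n)
      unit-n = unit-root (z ℕ.∸ x) (ℕ.m<n⇒0<n∸m x<z) (subst (Unit m)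
        (trans (sym (pos-^ u₂ x)) (trans (cong +_ (sym n^≡u₂^)) (pos-^ n (z ℕ.∸ x)))) (unit-^ x unit-u₂))

      lhs rhs : ℤ
      lhs = 4u ℤ.^ y ℤ.* (+ n) ℤ.^ (y ℕ.∸ z)
      rhs = (+ u₁) ℤ.^ x

      -- Modulo U the equation reads `lhs` ≡ -`rhs`. Multiplying by 4 and using -4 ≡ u² leaves
      -- square factors on both sides, so the symbol of -1 is never evaluated.
      4*lhs≡u²*rhs : + 4 ℤ.* lhs ≋ + u ℤ.* + u ℤ.* rhs [mod m ]
      4*lhs≡u²*rhs with ℕ.<-trans 0<x x<z
      -- Since z > 0, a factor m splits off from `lhs` + `rhs` = mᶻ; the subtracted `rhs` comes from
      -- writing u² as m - 4.
      ... | s≤s {n = z-1} _ = congruent (+ 4 ℤ.* (+ m) ℤ.^ z-1 ℤ.- rhs) (begin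
        + 4 ℤ.* lhs
          ≡⟨ lemma lhs rhs (+ u) ⟩
        + u ℤ.* + u ℤ.* rhs ℤ.+ (+ 4 ℤ.* (lhs ℤ.+ rhs) ℤ.- (+ u ℤ.* + u ℤ.+ + 4) ℤ.* rhs)
          ≡⟨ cong₂ (λ s t → + u ℤ.* + u ℤ.* rhs ℤ.+ (+ 4 ℤ.* s ℤ.- t ℤ.* rhs)) lhs+rhs≡ (sym +m≡u²+4) ⟩
        + u ℤ.* + u ℤ.* rhs ℤ.+ (+ 4 ℤ.* (+ m ℤ.* (+ m) ℤ.^ z-1) ℤ.- + m ℤ.* rhs)
          ≡⟨ lemma′ (+ u ℤ.* + u ℤ.* rhs) ((+ m) ℤ.^ z-1) rhs (+ m) ⟩
        + u ℤ.* + u ℤ.* rhs ℤ.+ (+ 4 ℤ.* (+ m) ℤ.^ z-1 ℤ.- rhs) ℤ.* + m ∎)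
        where
        open ≡-Reasoning
        lhs+rhs≡ : lhs ℤ.+ rhs ≡ (+ m) ℤ.^ suc z-1
        lhs+rhs≡ = trans (cong (λ s → s ℤ.* (+ n) ℤ.^ (y ℕ.∸ suc z-1) ℤ.+ rhs) (sym (pos-^ (4 ℕ.* u) y)))
          (trans (sym equation-ℤ) (cong (λ s → (+ s) ℤ.^ suc z-1) U≡1+2h))
        lemma : ∀ a b u → + 4 ℤ.* a ≡ u ℤ.* u ℤ.* b ℤ.+ (+ 4 ℤ.* (a ℤ.+ b) ℤ.- (u ℤ.* u ℤ.+ + 4) ℤ.* b)
        lemma = ℤ-Solver.solve-∀
        lemma′ : ∀ a b c m → a ℤ.+ (+ 4 ℤ.* (m ℤ.* b) ℤ.- m ℤ.* c) ≡ a ℤ.+ (+ 4 ℤ.* b ℤ.- c) ℤ.* m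
        lemma′ = ℤ-Solver.solve-∀

      jacobi-lhs≡jacobi-rhs : jacobi lhs ≡ jacobi rhs
      jacobi-lhs≡jacobi-rhs = begin
        jacobi lhs                          ≡⟨ cong (ℙ._+ jacobi lhs) (jacobi-square unit-2) ⟨
        jacobi (+ 4) ℙ.+ jacobi lhs         ≡⟨ jacobi-* {a = + 4} unit-4 unit-lhs ⟨
        jacobi (+ 4 ℤ.* lhs)                ≡⟨ jacobi-cong (unit-* (unit-* unit-u unit-u) unit-rhs) 4*lhs≡u²*rhs ⟩
        jacobi (+ u ℤ.* + u ℤ.* rhs)        ≡⟨ jacobi-* (unit-* unit-u unit-u) unit-rhs ⟩
        jacobi (+ u ℤ.* + u) ℙ.+ jacobi rhs ≡⟨ cong (ℙ._+ jacobi rhs) (jacobi-square unit-u) ⟩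
        jacobi rhs                          ∎
        where
        open ≡-Reasoning
        unit-lhs : Unit m lhs
        unit-lhs = unit-* (unit-^ y unit-4u) (unit-^ (y ℕ.∸ z) unit-n)
        unit-rhs : Unit m rhs
        unit-rhs = unit-^ x unit-u₁

      -- As z is even and y odd, y - z is odd. Since 4u has trivial symbol, `lhs` has the symbol of
      -- n, while `rhs` is a power of u₁ and has trivial symbol.
      jacobi-n : ℕ.parity y ≡ 1ℙ → jacobi (+ n) ≡ 0ℙ
      jacobi-n y-odd = begin
        jacobi (+ n)                                                ≡⟨ cong (ℙ._* jacobi (+ n)) y∸z-odd ⟨
        ℕ.parity (y ℕ.∸ z) ℙ.* jacobi (+ n)                         ≡⟨ jacobi-^ (y ℕ.∸ z) unit-n ⟨
        jacobi ((+ n) ℤ.^ (y ℕ.∸ z))                                ≡⟨ cong (ℙ._+ jacobi ((+ n) ℤ.^ (y ℕ.∸ z))) jacobi-4u^y ⟨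
        jacobi (4u ℤ.^ y) ℙ.+ jacobi ((+ n) ℤ.^ (y ℕ.∸ z))          ≡⟨ jacobi-* (unit-^ y unit-4u) (unit-^ (y ℕ.∸ z) unit-n) ⟨
        jacobi lhs                                                  ≡⟨ jacobi-lhs≡jacobi-rhs ⟩
        jacobi rhs                                                  ≡⟨ jacobi-^ x unit-u₁ ⟩
        ℕ.parity x ℙ.* jacobi (+ u₁)                                ≡⟨ cong (ℕ.parity x ℙ.*_) (proj₂ u₁-symbol) ⟩
        ℕ.parity x ℙ.* 0ℙ                                           ≡⟨ ℙ.*-zeroʳ (ℕ.parity x) ⟩
        0ℙ                                                          ∎
        where
        open ≡-Reasoning
        jacobi-4u^y : jacobi (4u ℤ.^ y) ≡ 0ℙ
        jacobi-4u^y = trans (jacobi-^ y unit-4u) (trans (cong (ℕ.parity y ℙ.*_) jacobi-4u) (ℙ.*-zeroʳ (ℕ.parity y)))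
        y∸z-odd : ℕ.parity (y ℕ.∸ z) ≡ 1ℙ
        y∸z-odd = begin
          ℕ.parity (y ℕ.∸ z)                    ≡⟨ ℙ.+-identityʳ _ ⟨
          ℕ.parity (y ℕ.∸ z) ℙ.+ 0ℙ             ≡⟨ cong (ℕ.parity (y ℕ.∸ z) ℙ.+_) z-even ⟨
          ℕ.parity (y ℕ.∸ z) ℙ.+ ℕ.parity z     ≡⟨ ℙ.+-homo-+ (y ℕ.∸ z) z ⟨
          ℕ.parity (y ℕ.∸ z ℕ.+ z)              ≡⟨ cong ℕ.parity (ℕ.m∸n+n≡m (ℕ.<⇒≤ z<y)) ⟩
          ℕ.parity y                            ≡⟨ y-odd ⟩
          1ℙ                                    ∎

      reciprocity-case : ∀ x′ w → n ℕ.^ w ≡ u₂ ℕ.^ x′ → ℕ.parity y ≡ 1ℙ →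
        ¬ (ℕ.parity w ≡ 1ℙ × ℕ.parity x′ ≡ 1ℙ)
      reciprocity-case x′ w n^w≡ y-odd (w-odd , x′-odd) = contradiction (begin
        0ℙ                                  ≡⟨ jacobi-n y-odd ⟨
        jacobi (+ n)                        ≡⟨ cong (ℙ._* jacobi (+ n)) w-odd ⟨
        ℕ.parity w ℙ.* jacobi (+ n)         ≡⟨ jacobi-^ w unit-n ⟨
        jacobi ((+ n) ℤ.^ w)                ≡⟨ cong jacobi (trans (sym (pos-^ n w)) (trans (cong +_ n^w≡) (pos-^ u₂ x′))) ⟩
        jacobi ((+ u₂) ℤ.^ x′)              ≡⟨ jacobi-^ x′ unit-u₂ ⟩
        ℕ.parity x′ ℙ.* jacobi (+ u₂)       ≡⟨ cong₂ ℙ._*_ x′-odd (proj₂ u₂-symbol) ⟩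
        1ℙ                                  ∎) λ ()
        where open ≡-Reasoning

  y-not-odd : ¬ (ℕ.parity y ≡ 1ℙ)
  y-not-odd y-odd with reduce x (z ℕ.∸ x) 0<x
  ... | k , x′ , w , x≡ , z∸x≡ , odd = cases (ℕ.parity x′) (ℕ.parity w) refl refl odd
    where
    n^w≡u₂^x′ : n ℕ.^ w ≡ u₂ ℕ.^ x′
    -- Both sides of `n^≡u₂^` are 2ᵏ-th powers, and roots of natural numbers are unique.
    n^w≡u₂^x′ = ^-injectiveˡ (2 ℕ.^ k) {{ℕ.m^n≢0 2 k}} (trans (ℕ.^-*-assoc n w (2 ℕ.^ k))
      (trans (cong (n ℕ.^_) (sym z∸x≡)) (trans n^≡u₂^ (trans (cong (u₂ ℕ.^_) x≡) (sym (ℕ.^-*-assoc u₂ x′ (2 ℕ.^ k)))))))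
    cases : ∀ p q → ℕ.parity x′ ≡ p → ℕ.parity w ≡ q → ¬ (ℕ.parity x′ ≡ 1ℙ ⊎ ℕ.parity w ≡ 1ℙ)
    cases 0ℙ 0ℙ x′-even w-even (inj₁ x′-odd) = contradiction (trans (sym x′-even) x′-odd) λ ()
    cases 0ℙ 0ℙ x′-even w-even (inj₂ w-odd)  = contradiction (trans (sym w-even) w-odd) λ ()
    cases 0ℙ 1ℙ x′-even w-odd  _ = 2-adic-case k x′ w x≡ z∸x≡ (w-odd , x′-even)
    cases 1ℙ 0ℙ x′-odd  w-even _ = square-case x′ w n^w≡u₂^x′ (w-even , x′-odd)
    cases 1ℙ 1ℙ x′-odd  w-odd  _ = reciprocity-case (proj₁ halve-U) (proj₁ (proj₂ halve-U)) (proj₁ (proj₂ (proj₂ halve-U))) x′ w n^w≡u₂^x′ y-odd (w-odd , x′-odd)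

theorem1p3 : ∀ (u x y z n u₁ u₂ : ℕ) → Prime u → ¬ (2 ∣ u) →
    Exceptional u x y z n →
    x < z → z < y →
    0 < u₁ → 0 < u₂ → Coprime u₁ u₂ → u₁ * u₂ ≡ u * u ∸ 4 →
    (u * u + 4) ^ z ≡ (4 * u) ^ y * n ^ (y ∸ z) + u₁ ^ x →
    n ^ (z ∸ x) ≡ u₂ ^ x →
    (u₁ % 8 ≡ 1 ⊎ u₁ % 8 ≡ 7) →
    2 ∣ y
theorem1p3 u x y z n u₁ u₂ _ 2∤u ((0<x , _) , _) x<z z<y 0<u₁ 0<u₂ _ u₁u₂≡u²∸4 equation n^≡u₂^ u₁%8 =
  even⇒2∣ y (not-odd⇒even (y-not-odd {u = u} u-odd 0<x x<z z<y U≡u₁u₂+8 equation n^≡u₂^ u₁≡±1))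
  where
  not-odd⇒even : ∀ {p} → p ≢ 1ℙ → p ≡ 0ℙ
  not-odd⇒even {0ℙ} _   = refl
  not-odd⇒even {1ℙ} p≢1 = contradiction refl p≢1

  not-even⇒odd : ∀ {p} → p ≢ 0ℙ → p ≡ 1ℙ
  not-even⇒odd {0ℙ} p≢0 = contradiction refl p≢0
  not-even⇒odd {1ℙ} _   = refl

  u-odd : ℕ.parity u ≡ 1ℙ
  u-odd = not-even⇒odd (λ u-even → 2∤u (even⇒2∣ u u-even))

  -- The product u₁u₂ is positive, so the subtraction in u² - 4 is not truncated.
  4≤u² : 4 ≤ u * u
  4≤u² = ℕ.<⇒≤ (ℕ.m∸n≢0⇒n<m λ u²∸4≡0 →
    ℕ.<⇒≢ (ℕ.*-mono-< 0<u₁ 0<u₂) (sym (trans u₁u₂≡u²∸4 u²∸4≡0)))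

  U≡u₁u₂+8 : u * u + 4 ≡ u₁ * u₂ + 8
  U≡u₁u₂+8 = trans (cong (_+ 4) (trans (sym (ℕ.m∸n+n≡m 4≤u²)) (cong (_+ 4) (sym u₁u₂≡u²∸4))))
    (ℕ.+-assoc (u₁ * u₂) 4 4)

  ≡-mod-8 : ∀ r → u₁ % 8 ≡ r → ℤ.+ u₁ ≋ ℤ.+ r [mod 8 ]
  ≡-mod-8 r u₁%8≡r = subst (λ s → ℤ.+ u₁ ≋ ℤ.+ s [mod 8 ]) u₁%8≡r (%⇒≡ u₁ 8)

  u₁≡±1 : ℤ.+ u₁ ≋ ℤ.+ 1 [mod 8 ] ⊎ ℤ.+ u₁ ≋ ℤ.+ 7 [mod 8 ]
  u₁≡±1 = map (≡-mod-8 1) (≡-mod-8 7) u₁%8
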